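{- The class of (countably infinite) poset trees is not punctually robust: there is a computable poset tree $(\mathbb N,\le)$ that is not isomorphic to any punctual poset tree.
   Context: A poset tree is a partial order $(P,\le)$ with a greatest element (the root) such that for every $x\in P$ the set $P_{\ge x}=\{y\in P: y\ge x\}$ is a finite linear order. A structure is computable if its domain is a computable subset of $\mathbb N$ and its relations are computable; it is punctual if its domain is $\mathbb N$ and its relations are primitive recursive. A class is punctually robust if each of its computable members is isomorphic to a punctual structure. -}

module Defs where

open import Data.Nat using (ℕ; zero; suc; _<_)
open import Data.Fin using (Fin)
open import Data.Vec using (Vec; []; _∷_; lookup)
open import Data.Bool using (Bool; true; false)
open import Data.List using (List)
open import Data.List.Membership.Propositional using (_∈_)
open import Data.Product using (Σ; ∃; _×_; _,_)
open import Data.Sum using (_⊎_)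
open import Relation.Binary.PropositionalEquality using (_≡_)
open import Function.Bundles using (_⤖_; Bijection)

data PR : ℕ → Set where
  pzero : ∀ {n} → PR n
  psucc : PR 1
  pproj : ∀ {n} → Fin n → PR n
  pcomp : ∀ {m n} → PR m → Vec (PR n) m → PR n
  prec  : ∀ {n} → PR n → PR (suc (suc n)) → PR (suc n)

mutual
  evalPR : ∀ {n} → PR n → Vec ℕ n → ℕ
  evalPR pzero xs = 0
  evalPR psucc (x ∷ []) = suc x
  evalPR (pproj i) xs = lookup xs i
  evalPR (pcomp f gs) xs = evalPR f (evalPRs gs xs)
  evalPR (prec f g) (zero ∷ xs) = evalPR f xs
  evalPR (prec f g) (suc k ∷ xs) = evalPR g (k ∷ evalPR (prec f g) (k ∷ xs) ∷ xs)

  evalPRs : ∀ {m n} → Vec (PR n) m → Vec ℕ n → Vec ℕ m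
  evalPRs [] xs = []
  evalPRs (g ∷ gs) xs = evalPR g xs ∷ evalPRs gs xs

data Rec : ℕ → Set where
  rzero : ∀ {n} → Rec n
  rsucc : Rec 1
  rproj : ∀ {n} → Fin n → Rec n
  rcomp : ∀ {m n} → Rec m → Vec (Rec n) m → Rec n
  rrec  : ∀ {n} → Rec n → Rec (suc (suc n)) → Rec (suc n)
  rmu   : ∀ {n} → Rec (suc n) → Rec n

mutual
  data _⊢_⇓_ : ∀ {n} → Rec n → Vec ℕ n → ℕ → Set where
    ⇓zero : ∀ {n} {xs : Vec ℕ n} → rzero ⊢ xs ⇓ 0
    ⇓succ : ∀ {x} → rsucc ⊢ (x ∷ []) ⇓ suc x
    ⇓proj : ∀ {n} {i : Fin n} {xs} → rproj i ⊢ xs ⇓ lookup xs i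
    ⇓comp : ∀ {m n} {f : Rec m} {gs : Vec (Rec n) m} {xs ys y} →
            gs ⊢* xs ⇓ ys → f ⊢ ys ⇓ y → rcomp f gs ⊢ xs ⇓ y
    ⇓rec0 : ∀ {n} {f : Rec n} {g xs y} →
            f ⊢ xs ⇓ y → rrec f g ⊢ (zero ∷ xs) ⇓ y
    ⇓recS : ∀ {n} {f : Rec n} {g k xs z y} →
            rrec f g ⊢ (k ∷ xs) ⇓ z → g ⊢ (k ∷ z ∷ xs) ⇓ y →
            rrec f g ⊢ (suc k ∷ xs) ⇓ y
    ⇓mu   : ∀ {n} {f : Rec (suc n)} {xs y} →
            f ⊢ (y ∷ xs) ⇓ 0 →
            (∀ z → z < y → ∃ λ w → f ⊢ (z ∷ xs) ⇓ suc w) →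
            rmu f ⊢ xs ⇓ y

  data _⊢*_⇓_ : ∀ {m n} → Vec (Rec n) m → Vec ℕ n → Vec ℕ m → Set where
    []  : ∀ {n} {xs : Vec ℕ n} → [] ⊢* xs ⇓ []
    _∷_ : ∀ {m n} {g : Rec n} {gs : Vec (Rec n) m} {xs y ys} →
          g ⊢ xs ⇓ y → gs ⊢* xs ⇓ ys → (g ∷ gs) ⊢* xs ⇓ (y ∷ ys)

BinRel : Set
BinRel = ℕ → ℕ → Bool

χ : Bool → ℕ
χ true  = 1
χ false = 0

Computable : BinRel → Set
Computable R = Σ (Rec 2) λ c → ∀ x y → c ⊢ (x ∷ y ∷ []) ⇓ χ (R x y)

Punctual : BinRel → Set
Punctual R = Σ (PR 2) λ c → ∀ x y → evalPR c (x ∷ y ∷ []) ≡ χ (R x y)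

_⊑[_]_ : ℕ → BinRel → ℕ → Set
x ⊑[ R ] y = R x y ≡ true

record IsPosetTree (R : BinRel) : Set where
  field
    refl    : ∀ x → x ⊑[ R ] x
    antisym : ∀ x y → x ⊑[ R ] y → y ⊑[ R ] x → x ≡ y
    trans   : ∀ x y z → x ⊑[ R ] y → y ⊑[ R ] z → x ⊑[ R ] z
    root    : ℕ
    greatest : ∀ x → x ⊑[ R ] root
    coneLinear : ∀ x y z → x ⊑[ R ] y → x ⊑[ R ] z →
                 (y ⊑[ R ] z) ⊎ (z ⊑[ R ] y)
    coneFinite : ∀ x → Σ (List ℕ) λ L → ∀ y → x ⊑[ R ] y → y ∈ L

Isomorphic : BinRel → BinRel → Set
Isomorphic R S = Σ (ℕ ⤖ ℕ) λ f →
  ∀ x y → (x ⊑[ R ] y → Bijection.to f x ⊑[ S ] Bijection.to f y)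
        × (Bijection.to f x ⊑[ S ] Bijection.to f y → x ⊑[ R ] y)

{-# OPTIONS --safe #-}
module Submission where

-- The tree grows in stages.  Stage t carries an infinite bit string d₀(t) d₁(t) …, which is inserted into a
-- digital search tree: it gets a new node at its shortest prefix not yet occupied, together with two marks below
-- that node whose shape (a fork or a chain) displays the last bit of the prefix.  The bits at index e fight the
-- e-th structure S.  If S is isomorphic to the tree, then only finitely many elements have rank ≤ e + 3, so once
-- these have appeared in a finite part of S one can tell, for every element z of that part, whether bit e is 0 at
-- z.  As long as S does not show more such elements than the tree itself can contain, the stages choose bit 0,
-- otherwise bit 1.  An excess is permanent, since the 0-side then never grows again, and contradicts the
-- isomorphism.  So bit e is eventually always 0, all but finitely many elements lie on the 0-side, and S, which
-- being total shows 4t elements when the tree has only 3t, must show an excess after all.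
--
-- Primitive recursive relations are enumerated by a stack machine for a point-free language of unary functions on
-- coded pairs; all its programs halt, so the tree is computable.

open import Defs
open import Data.Bool using (Bool; true; false; _∧_; _∨_; not; if_then_else_)
open import Data.Bool.Properties using (T-≡)
open import Data.Empty using (⊥; ⊥-elim)
open import Data.Fin using (Fin; zero; suc)
open import Data.Fin.Patterns using (0F; 1F; 2F; 3F)
open import Data.List using (upTo)
open import Data.List.Membership.Propositional.Properties using (∈-upTo⁺)
open import Data.Nat
open import Data.Nat.Induction using (<-rec)
open import Data.Nat.Properties
open import Data.Product using (Σ; ∃; _×_; _,_; proj₁; proj₂)
open import Data.Sum using (_⊎_; inj₁; inj₂)
open import Data.Vec using (Vec; []; _∷_; lookup; head; tail; tabulate)
open import Data.Vec.Properties using (tabulate∘lookup)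
open import Function using (_∘_; Equivalence)
open import Function.Bundles using (Bijection)
open import Relation.Binary.Definitions using (tri<; tri≈; tri>)
open import Relation.Binary.PropositionalEquality
open import Relation.Nullary using (¬_; yes; no)

private variable
  m n : ℕ

-- Total recursive functions

-- The function is given first and the program only has to reach its values, so the study of the
-- tree never inspects a derivation.
record Comp {n} (f : Vec ℕ n → ℕ) : Set where
  constructor comp
  field
    prog : Rec n
    runs : ∀ xs → prog ⊢ xs ⇓ f xs
open Comp

record CompB {n} (P : Vec ℕ n → Bool) : Set where
  constructor compB
  field
    char : Comp (λ xs → χ (P xs))
open CompB

ext : {f g : Vec ℕ n → ℕ} → (∀ xs → f xs ≡ g xs) → Comp f → Comp g
ext eq c = comp (prog c) λ xs → subst (prog c ⊢ xs ⇓_) (eq xs) (runs c xs)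

extB : {P Q : Vec ℕ n → Bool} → (∀ xs → P xs ≡ Q xs) → CompB P → CompB Q
extB eq c = compB (ext (λ xs → cong χ (eq xs)) (char c))

fromχ : {P : Vec ℕ n → Bool} {f : Vec ℕ n → ℕ} → (∀ xs → f xs ≡ χ (P xs)) → Comp f → CompB P
fromχ eq c = compB (ext eq c)

var : (i : Fin n) → Comp (λ xs → lookup xs i)
var i = comp (rproj i) λ xs → ⇓proj

projs : (Fin m → Fin n) → Vec (Rec n) m
projs {zero}  ρ = []
projs {suc m} ρ = rproj (ρ zero) ∷ projs (ρ ∘ suc)

projs⇓ : (ρ : Fin m → Fin n) (xs : Vec ℕ n) → projs ρ ⊢* xs ⇓ tabulate (lookup xs ∘ ρ)
projs⇓ {zero}  ρ xs = []
projs⇓ {suc m} ρ xs = ⇓proj ∷ projs⇓ (ρ ∘ suc) xs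

rename : (ρ : Fin m → Fin n) {f : Vec ℕ m → ℕ} → Comp f → Comp (λ xs → f (tabulate (lookup xs ∘ ρ)))
rename {n = n} ρ c = comp (rcomp (prog c) (projs ρ)) λ xs → ⇓comp (projs⇓ ρ xs) (runs c _)

-- In the step of a recursion the counter and the previous value precede the parameters.
weaken₂ : {f : Vec ℕ n → ℕ} → Comp f → Comp {suc (suc n)} (λ xs → f (tail (tail xs)))
weaken₂ {f = f} c = ext (λ { (_ ∷ _ ∷ xs) → cong f (tabulate∘lookup xs) }) (rename (λ i → suc (suc i)) c)

skip₁ : {f : Vec ℕ (suc n) → ℕ} → Comp f → Comp {suc (suc n)} (λ xs → f (head xs ∷ tail (tail xs)))
skip₁ {n = n} {f} c = ext (λ { (x ∷ _ ∷ xs) → cong (λ ys → f (x ∷ ys)) (tabulate∘lookup xs) }) (rename ρ c)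
  where
  ρ : Fin (suc n) → Fin (suc (suc n))
  ρ zero    = zero
  ρ (suc i) = suc (suc i)

-- Since `h` specifies the values, `g` has to be right only at the true previous value.
recAt : (h : ℕ → Vec ℕ n → ℕ) {f : Vec ℕ n → ℕ} {g : Vec ℕ (suc (suc n)) → ℕ} {b : Vec ℕ n → ℕ} →
        (∀ xs → f xs ≡ h 0 xs) → (∀ k xs → g (k ∷ h k xs ∷ xs) ≡ h (suc k) xs) →
        Comp f → Comp g → Comp b → Comp (λ xs → h (b xs) xs)
recAt {n} h {f} {g} {b} h0 hS cf cg cb =
  comp (rcomp r (prog cb ∷ ids)) λ xs → ⇓comp (runs cb xs ∷ ids⇓ xs) (go (b xs) xs)
  where
  r = rrec (prog cf) (prog cg)
  go : ∀ k xs → r ⊢ (k ∷ xs) ⇓ h k xs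
  go zero    xs = ⇓rec0 (subst (prog cf ⊢ xs ⇓_) (h0 xs) (runs cf xs))
  go (suc k) xs = ⇓recS (go k xs) (subst (prog cg ⊢ (k ∷ h k xs ∷ xs) ⇓_) (hS k xs) (runs cg _))
  ids : Vec (Rec n) n
  ids = projs (λ i → i)
  ids⇓ : ∀ xs → ids ⊢* xs ⇓ xs
  ids⇓ xs = subst (ids ⊢* xs ⇓_) (tabulate∘lookup xs) (projs⇓ (λ i → i) xs)

-- The only use of unbounded search. Its result `μ` is known beforehand, so nothing has to be
-- extracted from a derivation.
minimise : (μ : Vec ℕ n → ℕ) {f : Vec ℕ (suc n) → ℕ} → (∀ xs → f (μ xs ∷ xs) ≡ 0) →
           (∀ xs z → z < μ xs → f (z ∷ xs) ≢ 0) → Comp f → Comp μ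
minimise μ {f} hit before c = comp (rmu (prog c)) λ xs →
  ⇓mu (subst (prog c ⊢ _ ⇓_) (hit xs) (runs c _)) λ z z<μ → positive _ (before xs z z<μ) (runs c (z ∷ xs))
  where
  positive : ∀ k {v} → k ≢ 0 → prog c ⊢ v ⇓ k → ∃ λ w → prog c ⊢ v ⇓ suc w
  positive zero    k≢0 _ = ⊥-elim (k≢0 refl)
  positive (suc w) _   r = w , r

-- Wrapping each arity in a record keeps the function argument inferable by unification.
record Fun₁ (f : ℕ → ℕ) : Set where
  constructor fun₁
  field body : Comp {1} (λ xs → f (lookup xs 0F))

record Fun₂ (f : ℕ → ℕ → ℕ) : Set where
  constructor fun₂
  field body : Comp {2} (λ xs → f (lookup xs 0F) (lookup xs 1F))

record Fun₃ (f : ℕ → ℕ → ℕ → ℕ) : Set where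
  constructor fun₃
  field body : Comp {3} (λ xs → f (lookup xs 0F) (lookup xs 1F) (lookup xs 2F))

record Rel₂ (P : ℕ → ℕ → Bool) : Set where
  constructor rel₂
  field body : CompB {2} (λ xs → P (lookup xs 0F) (lookup xs 1F))

record Rel₃ (P : ℕ → ℕ → ℕ → Bool) : Set where
  constructor rel₃
  field body : CompB {3} (λ xs → P (lookup xs 0F) (lookup xs 1F) (lookup xs 2F))

module _ {a : Vec ℕ n → ℕ} (ca : Comp a) where
  app₁ : ∀ {f} → Fun₁ f → Comp (λ xs → f (a xs))
  app₁ (fun₁ c) = comp (rcomp (prog c) (prog ca ∷ [])) λ xs → ⇓comp (runs ca xs ∷ []) (runs c _)

  module _ {b : Vec ℕ n → ℕ} (cb : Comp b) where
    app₂ : ∀ {f} → Fun₂ f → Comp (λ xs → f (a xs) (b xs))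
    app₂ (fun₂ c) = comp (rcomp (prog c) (prog ca ∷ prog cb ∷ [])) λ xs →
      ⇓comp (runs ca xs ∷ runs cb xs ∷ []) (runs c _)

    appB₂ : ∀ {P} → Rel₂ P → CompB (λ xs → P (a xs) (b xs))
    appB₂ (rel₂ (compB c)) = compB (comp (rcomp (prog c) (prog ca ∷ prog cb ∷ [])) λ xs →
      ⇓comp (runs ca xs ∷ runs cb xs ∷ []) (runs c _))

    module _ {d : Vec ℕ n → ℕ} (cd : Comp d) where
      app₃ : ∀ {f} → Fun₃ f → Comp (λ xs → f (a xs) (b xs) (d xs))
      app₃ (fun₃ c) = comp (rcomp (prog c) (prog ca ∷ prog cb ∷ prog cd ∷ [])) λ xs →
        ⇓comp (runs ca xs ∷ runs cb xs ∷ runs cd xs ∷ []) (runs c _)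

      appB₃ : ∀ {P} → Rel₃ P → CompB (λ xs → P (a xs) (b xs) (d xs))
      appB₃ (rel₃ (compB c)) = compB (comp (rcomp (prog c) (prog ca ∷ prog cb ∷ prog cd ∷ [])) λ xs →
        ⇓comp (runs ca xs ∷ runs cb xs ∷ runs cd xs ∷ []) (runs c _))

sucF : Fun₁ suc
sucF = fun₁ (comp rsucc λ { (x ∷ []) → ⇓succ })

sucC : {a : Vec ℕ n → ℕ} → Comp a → Comp (λ xs → suc (a xs))
sucC ca = app₁ ca sucF

numC : (k : ℕ) → Comp {n} (λ _ → k)
numC zero    = comp rzero λ xs → ⇓zero
numC (suc k) = sucC (numC k)

module _ {a b : Vec ℕ n → ℕ} (ca : Comp a) (cb : Comp b) where
  addC : Comp (λ xs → a xs + b xs)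
  addC = recAt (λ k xs → k + b xs) (λ _ → refl) (λ _ _ → refl) cb (sucC (var 1F)) ca

  mulC : Comp (λ xs → a xs * b xs)
  mulC = recAt (λ k xs → k * b xs) (λ _ → refl) (λ _ _ → refl) (numC 0) (app₂ (weaken₂ cb) (var 1F) addF) ca
    where
    addF : Fun₂ _+_
    addF = fun₂ (recAt (λ k xs → k + lookup xs 1F) (λ _ → refl) (λ _ _ → refl) (var 1F) (sucC (var 1F)) (var 0F))

predC : {a : Vec ℕ n → ℕ} → Comp a → Comp (λ xs → pred (a xs))
predC ca = recAt (λ k _ → pred k) (λ _ → refl) (λ _ _ → refl) (numC 0) (var 0F) ca

subC : {a b : Vec ℕ n → ℕ} → Comp a → Comp b → Comp (λ xs → a xs ∸ b xs)
subC {a = a} ca cb = recAt (λ k xs → a xs ∸ k) (λ _ → refl) (λ k xs → pred[m∸n]≡m∸[1+n] (a xs) k)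
  ca (predC (var 1F)) cb

module _ {P : Vec ℕ n → Bool} (cP : CompB P) where
  notC : CompB (λ xs → not (P xs))
  notC = fromχ (λ xs → eq (P xs)) (subC (numC 1) (char cP))
    where
    eq : ∀ p → 1 ∸ χ p ≡ χ (not p)
    eq true  = refl
    eq false = refl

  ifC : {a b : Vec ℕ n → ℕ} → Comp a → Comp b → Comp (λ xs → if P xs then a xs else b xs)
  ifC {a} {b} ca cb = ext (λ xs → eq (P xs) (a xs) (b xs))
    (addC (mulC (char cP) ca) (mulC (subC (numC 1) (char cP)) cb))
    where
    eq : ∀ p x y → χ p * x + (1 ∸ χ p) * y ≡ (if p then x else y)
    eq true  x y = trans (+-identityʳ (1 * x)) (*-identityˡ x)
    eq false x y = *-identityˡ y

module _ {P Q : Vec ℕ n → Bool} (cP : CompB P) (cQ : CompB Q) where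
  andC : CompB (λ xs → P xs ∧ Q xs)
  andC = fromχ (λ xs → eq (P xs) (Q xs)) (mulC (char cP) (char cQ))
    where
    eq : ∀ p q → χ p * χ q ≡ χ (p ∧ q)
    eq true  q = *-identityˡ (χ q)
    eq false q = refl

orC : {P Q : Vec ℕ n → Bool} → CompB P → CompB Q → CompB (λ xs → P xs ∨ Q xs)
orC {P = P} {Q} cP cQ = extB (λ xs → eq (P xs) (Q xs)) (notC (andC (notC cP) (notC cQ)))
  where
  eq : ∀ p q → not (not p ∧ not q) ≡ p ∨ q
  eq true  q     = refl
  eq false true  = refl
  eq false false = refl

module _ {a b : Vec ℕ n → ℕ} (ca : Comp a) (cb : Comp b) where
  ltC : CompB (λ xs → a xs <ᵇ b xs)
  ltC = fromχ (λ xs → eq (a xs) (b xs)) (subC (numC 1) (subC (sucC ca) cb))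
    where
    eq : ∀ x y → 1 ∸ (suc x ∸ y) ≡ χ (x <ᵇ y)
    eq x       zero    = 0∸n≡0 x
    eq zero    (suc y) = cong (1 ∸_) (0∸n≡0 y)
    eq (suc x) (suc y) = eq x y

eqC : {a b : Vec ℕ n → ℕ} → Comp a → Comp b → CompB (λ xs → a xs ≡ᵇ b xs)
eqC {a = a} {b} ca cb = extB (λ xs → eq (a xs) (b xs)) (andC (notC (ltC ca cb)) (notC (ltC cb ca)))
  where
  eq : ∀ x y → not (x <ᵇ y) ∧ not (y <ᵇ x) ≡ (x ≡ᵇ y)
  eq zero    zero    = refl
  eq zero    (suc y) = refl
  eq (suc x) zero    = refl
  eq (suc x) (suc y) = eq x y

_≡ᴮ_ : Bool → Bool → Bool
true  ≡ᴮ q = q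
false ≡ᴮ q = not q

eqBC : {P Q : Vec ℕ n → Bool} → CompB P → CompB Q → CompB (λ xs → P xs ≡ᴮ Q xs)
eqBC {P = P} {Q} cP cQ = extB (λ xs → eq (P xs) (Q xs)) (orC (andC cP cQ) (andC (notC cP) (notC cQ)))
  where
  eq : ∀ p q → (p ∧ q) ∨ (not p ∧ not q) ≡ (p ≡ᴮ q)
  eq true  true  = refl
  eq true  false = refl
  eq false q     = refl

-- Bounded quantification, counting and search

all< : ℕ → (ℕ → Bool) → Bool
all< zero    P = true
all< (suc n) P = all< n P ∧ P n

any< : ℕ → (ℕ → Bool) → Bool
any< n P = not (all< n (λ i → not (P i)))

count : ℕ → (ℕ → Bool) → ℕ
count zero    P = 0
count (suc n) P = χ (P n) + count n P

-- The least i < n with P i, and n if there is none.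
first : ℕ → (ℕ → Bool) → ℕ
first zero    P = 0
first (suc n) P = if (first n P ≡ᵇ n) ∧ not (P n) then suc n else first n P

module _ {b : Vec ℕ n → ℕ} {P : Vec ℕ (suc n) → Bool} (cb : Comp b) (cP : CompB P) where
  private
    P′ : CompB {suc (suc n)} (λ xs → P (head xs ∷ tail (tail xs)))
    P′ = compB (skip₁ (char cP))

  allC : CompB (λ xs → all< (b xs) (λ i → P (i ∷ xs)))
  allC = compB (recAt (λ k xs → χ (all< k (λ i → P (i ∷ xs)))) (λ _ → refl)
    (λ k xs → eq (all< k (λ i → P (i ∷ xs))) (P (k ∷ xs))) (numC 1) (mulC (var 1F) (char P′)) cb)
    where
    eq : ∀ p q → χ p * χ q ≡ χ (p ∧ q)
    eq true  q = *-identityˡ (χ q)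
    eq false q = refl

  countC : Comp (λ xs → count (b xs) (λ i → P (i ∷ xs)))
  countC = recAt (λ k xs → count k (λ i → P (i ∷ xs))) (λ _ → refl) (λ _ _ → refl)
    (numC 0) (addC (char P′) (var 1F)) cb

  firstC : Comp (λ xs → first (b xs) (λ i → P (i ∷ xs)))
  firstC = recAt (λ k xs → first k (λ i → P (i ∷ xs))) (λ _ → refl) (λ _ _ → refl)
    (numC 0) (ifC (andC (eqC (var 1F) (var 0F)) (notC P′)) (sucC (var 0F)) (var 1F)) cb

anyC : {b : Vec ℕ n → ℕ} {P : Vec ℕ (suc n) → Bool} → Comp b → CompB P →
       CompB (λ xs → any< (b xs) (λ i → P (i ∷ xs)))
anyC cb cP = notC (allC cb (notC cP))

-- Bounded quantifiers and counting

true≢false : ∀ {p} → p ≡ true → p ≢ false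
true≢false refl ()

∧-true : ∀ {p q} → p ∧ q ≡ true → p ≡ true × q ≡ true
∧-true {true} {true} refl = refl , refl

∧-intro : ∀ {p q} → p ≡ true → q ≡ true → p ∧ q ≡ true
∧-intro refl refl = refl

∨-true : ∀ {p q} → p ∨ q ≡ true → p ≡ true ⊎ q ≡ true
∨-true {true}  _ = inj₁ refl
∨-true {false} q = inj₂ q

∨-introˡ : ∀ {p} q → p ≡ true → p ∨ q ≡ true
∨-introˡ q refl = refl

∨-introʳ : ∀ p {q} → q ≡ true → p ∨ q ≡ true
∨-introʳ true  _ = refl
∨-introʳ false q = q

not-true : ∀ {p} → not p ≡ true → p ≡ false
not-true {false} _ = refl

not-false : ∀ {p} → not p ≡ false → p ≡ true
not-false {true} _ = refl

≡ᴮ⇒≡ : ∀ {p q} → (p ≡ᴮ q) ≡ true → p ≡ q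
≡ᴮ⇒≡ {true}  {true}  _ = refl
≡ᴮ⇒≡ {false} {false} _ = refl

≡⇒≡ᴮ : ∀ {p q} → p ≡ q → (p ≡ᴮ q) ≡ true
≡⇒≡ᴮ {true}  refl = refl
≡⇒≡ᴮ {false} refl = refl

≡ᵇ-true : ∀ {m n} → (m ≡ᵇ n) ≡ true → m ≡ n
≡ᵇ-true eq = ≡ᵇ⇒≡ _ _ (Equivalence.from T-≡ eq)

≡ᵇ-intro : ∀ {m n} → m ≡ n → (m ≡ᵇ n) ≡ true
≡ᵇ-intro {m} {n} eq = Equivalence.to T-≡ (≡⇒≡ᵇ m n eq)

<ᵇ-true : ∀ {m n} → (m <ᵇ n) ≡ true → m < n
<ᵇ-true eq = <ᵇ⇒< _ _ (Equivalence.from T-≡ eq)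

<ᵇ-intro : ∀ {m n} → m < n → (m <ᵇ n) ≡ true
<ᵇ-intro lt = Equivalence.to T-≡ (<⇒<ᵇ lt)

<ᵇ-false : ∀ {m n} → (m <ᵇ n) ≡ false → n ≤ m
<ᵇ-false eq = ≮⇒≥ λ lt → true≢false (<ᵇ-intro lt) eq

≢ᵇ-intro : ∀ m n → m ≢ n → not (m ≡ᵇ n) ≡ true
≢ᵇ-intro m n m≢n with m ≡ᵇ n in eq
... | true  = ⊥-elim (m≢n (≡ᵇ-true eq))
... | false = refl

≢ᵇ-true : ∀ {m n} → not (m ≡ᵇ n) ≡ true → m ≢ n
≢ᵇ-true eq m≡n = true≢false (≡ᵇ-intro m≡n) (not-true eq)

all<-true : ∀ n {P} → all< n P ≡ true → ∀ {i} → i < n → P i ≡ true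
all<-true (suc n) eq {i} i<1+n with ∧-true eq | m≤n⇒m<n∨m≡n (≤-pred i<1+n)
... | p , q | inj₁ i<n  = all<-true n p i<n
... | p , q | inj₂ refl = q

all<-intro : ∀ n {P} → (∀ i → i < n → P i ≡ true) → all< n P ≡ true
all<-intro zero    h = refl
all<-intro (suc n) h = ∧-intro (all<-intro n λ i i<n → h i (m≤n⇒m≤1+n i<n)) (h n ≤-refl)

any<-intro : ∀ n {P i} → i < n → P i ≡ true → any< n P ≡ true
any<-intro n {P} {i} i<n Pi with all< n (not ∘ P) in eq
... | true  = ⊥-elim (true≢false Pi (not-true (all<-true n eq i<n)))
... | false = refl

any<-true : ∀ n {P} → any< n P ≡ true → ∃ λ i → i < n × P i ≡ true
any<-true n {P} eq = go n (not-true eq)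
  where
  go : ∀ n → all< n (not ∘ P) ≡ false → ∃ λ i → i < n × P i ≡ true
  go (suc n) eq with P n in Pn
  ... | true  = n , ≤-refl , Pn
  ... | false with all< n (not ∘ P) in rest
  ...   | false with go n rest
  ...     | i , i<n , Pi = i , m≤n⇒m≤1+n i<n , Pi

first≤ : ∀ n P → first n P ≤ n
first≤ zero    P = z≤n
first≤ (suc n) P with (first n P ≡ᵇ n) ∧ not (P n)
... | true  = ≤-refl
... | false = m≤n⇒m≤1+n (first≤ n P)

first-before : ∀ n P {i} → i < first n P → P i ≡ false
first-before (suc n) P {i} i<f with (first n P ≡ᵇ n) ∧ not (P n) in eq
... | false = first-before n P i<f
... | true with ∧-true eq | m≤n⇒m<n∨m≡n (≤-pred i<f)
...   | p , q | inj₁ i<n  = first-before n P (subst (i <_) (sym (≡ᵇ-true p)) i<n)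
...   | p , q | inj₂ refl = not-true q

first-hit : ∀ n P → first n P < n → P (first n P) ≡ true
first-hit (suc n) P f<n with (first n P ≡ᵇ n) ∧ not (P n) in eq
... | true = ⊥-elim (<-irrefl refl f<n)
... | false with m≤n⇒m<n∨m≡n (first≤ n P)
...   | inj₁ lt = first-hit n P lt
...   | inj₂ f≡n with first n P ≡ᵇ n in e₁
...     | true  = subst (λ i → P i ≡ true) (sym f≡n) (not-false eq)
...     | false = ⊥-elim (true≢false (≡ᵇ-intro f≡n) e₁)

χ-mono : ∀ {p q} → (p ≡ true → q ≡ true) → χ p ≤ χ q
χ-mono {false} h = z≤n
χ-mono {true}  h rewrite h refl = ≤-refl

count-mono : ∀ n {P Q} → (∀ i → i < n → P i ≡ true → Q i ≡ true) → count n P ≤ count n Q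
count-mono zero    h = z≤n
count-mono (suc n) h = +-mono-≤ (χ-mono (h n ≤-refl)) (count-mono n λ i i<n → h i (m≤n⇒m≤1+n i<n))

count-true : ∀ n → count n (λ _ → true) ≡ n
count-true zero    = refl
count-true (suc n) = cong suc (count-true n)

count-not : ∀ n P → count n P + count n (not ∘ P) ≡ n
count-not zero    P = refl
count-not (suc n) P with P n
... | true  = cong suc (count-not n P)
... | false = trans (+-suc (count n P) _) (cong suc (count-not n P))

count-remove : ∀ n {P u} → u < n → P u ≡ true → count n (λ i → P i ∧ not (i ≡ᵇ u)) < count n P
count-remove (suc n) {P} {u} u<1+n Pu with m≤n⇒m<n∨m≡n (≤-pred u<1+n)
... | inj₁ u<n = +-mono-≤-< (χ-mono (proj₁ ∘ ∧-true)) (count-remove n u<n Pu)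
... | inj₂ refl rewrite Pu | ≡ᵇ-intro {u} refl = s≤s (count-mono n λ _ _ → proj₁ ∘ ∧-true)

-- A pigeonhole principle. The assignment is a relation `G`, because the value found for `i` may
-- depend on the proof of `Q i`. The value taken by the last index is removed from `P` before the
-- induction continues.
count-injection : ∀ m n {Q P} (G : ℕ → ℕ → Set) → (∀ {i j u} → G i u → G j u → i ≡ j) →
                  (∀ i → i < m → Q i ≡ true → ∃ λ u → u < n × P u ≡ true × G i u) → count m Q ≤ count n P
count-injection zero    n         G inj f = z≤n
count-injection (suc m) n {Q} {P} G inj f with Q m in Qm
... | false = count-injection m n G inj λ i i<m → f i (m≤n⇒m≤1+n i<m)
... | true with f m ≤-refl Qm
...   | u , u<n , Pu , Gmu = ≤-trans (s≤s (count-injection m n G inj f′)) (count-remove n u<n Pu)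
  where
  f′ : ∀ i → i < m → Q i ≡ true → ∃ λ v → v < n × P v ∧ not (v ≡ᵇ u) ≡ true × G i v
  f′ i i<m Qi with f i (m≤n⇒m≤1+n i<m) Qi
  ... | v , v<n , Pv , Giv = v , v<n ,
    ∧-intro Pv (≢ᵇ-intro v u λ { refl → <-irrefl (inj Giv Gmu) i<m }) , Giv

count≤ : ∀ m n {Q} (G : ℕ → ℕ → Set) → (∀ {i j u} → G i u → G j u → i ≡ j) →
         (∀ i → i < m → Q i ≡ true → ∃ λ u → u < n × G i u) → count m Q ≤ n
count≤ m n G inj f = subst (count m _ ≤_) (count-true n)
  (count-injection m n G inj λ i i<m Qi → let u , u<n , g = f i i<m Qi in u , u<n , refl , g)

≤count : ∀ m n {P} (G : ℕ → ℕ → Set) → (∀ {i j u} → G i u → G j u → i ≡ j) →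
         (∀ i → i < m → ∃ λ u → u < n × P u ≡ true × G i u) → m ≤ count n P
≤count m n G inj f = subst (_≤ count n _) (count-true m) (count-injection m n G inj λ i i<m _ → f i i<m)

image-bound : (f : ℕ → ℕ) → ∀ K → ∃ λ B → ∀ x → x < K → f x < B
image-bound f zero = 0 , λ _ ()
image-bound f (suc K) with image-bound f K
... | B , below = B ⊔ suc (f K) , λ x x<1+K → bound x (m≤n⇒m<n∨m≡n (≤-pred x<1+K))
  where
  bound : ∀ x → x < K ⊎ x ≡ K → f x < B ⊔ suc (f K)
  bound x (inj₁ x<K)  = <-≤-trans (below x x<K) (m≤m⊔n B _)
  bound x (inj₂ refl) = m≤n⊔m B (suc (f K))

-- For bounds that exist only up to double negation: finitely many of them still combine, by maxima.
¬¬-bounded-choice : ∀ M (P : ℕ → ℕ → Set) → (∀ {s B B′} → B ≤ B′ → P s B → P s B′) →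
                    (∀ s → ¬ ¬ ∃ (P s)) → ¬ ¬ (∃ λ B → ∀ s → s < M → P s B)
¬¬-bounded-choice zero    P up f k = k (0 , λ _ ())
¬¬-bounded-choice (suc M) P up f k = ¬¬-bounded-choice M P up f λ (B , all) → f M λ (B′ , last) →
  k (B ⊔ B′ , λ s s<1+M → combine B B′ all last s (m≤n⇒m<n∨m≡n (≤-pred s<1+M)))
  where
  combine : ∀ B B′ → (∀ s → s < M → P s B) → P M B′ → ∀ s → s < M ⊎ s ≡ M → P s (B ⊔ B′)
  combine B B′ all last s (inj₁ s<M)  = up (m≤m⊔n B B′) (all s s<M)
  combine B B′ all last s (inj₂ refl) = up (m≤n⊔m B B′) last

-- A universal function for the PR functions

tri : ℕ → ℕ
tri zero    = 0
tri (suc n) = suc n + tri n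

tri-mono : ∀ {m n} → m ≤ n → tri m ≤ tri n
tri-mono z≤n       = z≤n
tri-mono (s≤s m≤n) = +-mono-≤ (s≤s m≤n) (tri-mono m≤n)

n≤tri : ∀ n → n ≤ tri n
n≤tri zero    = z≤n
n≤tri (suc n) = m≤m+n (suc n) (tri n)

-- The index of the diagonal that contains the argument.
triRoot : ℕ → ℕ
triRoot zero    = 0
triRoot (suc n) = if suc n <ᵇ tri (suc (triRoot n)) then triRoot n else suc (triRoot n)

triRoot-bounds : ∀ n → tri (triRoot n) ≤ n × n < tri (suc (triRoot n))
triRoot-bounds zero = z≤n , s≤s z≤n
triRoot-bounds (suc n) with triRoot-bounds n | suc n <ᵇ tri (suc (triRoot n)) in eq
... | lo , hi | true  = m≤n⇒m≤1+n lo , <ᵇ-true eq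
... | lo , hi | false = <ᵇ-false eq ,
                        ≤-trans (s≤s hi) (s≤s (m≤n+m (tri (suc (triRoot n))) (suc (triRoot n))))

triRoot-unique : ∀ {n w} → tri w ≤ n → n < tri (suc w) → triRoot n ≡ w
triRoot-unique {n} {w} lo hi = ≤-antisym (bound (proj₁ (triRoot-bounds n)) hi) (bound lo (proj₂ (triRoot-bounds n)))
  where
  bound : ∀ {v u} → tri v ≤ n → n < tri (suc u) → v ≤ u
  bound {v} {u} a b = ≮⇒≥ λ u<v → <-irrefl refl (<-≤-trans b (≤-trans (tri-mono u<v) a))

abstract
  pair : ℕ → ℕ → ℕ
  pair x y = tri (x + y) + y

  π₂ : ℕ → ℕ
  π₂ n = n ∸ tri (triRoot n)

  π₁ : ℕ → ℕ
  π₁ n = triRoot n ∸ π₂ n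

  private
    triRoot-pair : ∀ x y → triRoot (pair x y) ≡ x + y
    triRoot-pair x y = triRoot-unique (m≤m+n _ y)
      (subst (pair x y <_) (+-comm (tri (x + y)) (suc (x + y))) (+-monoʳ-< (tri (x + y)) (s≤s (m≤n+m y x))))

  π₂-pair : ∀ x y → π₂ (pair x y) ≡ y
  π₂-pair x y = trans (cong (λ w → pair x y ∸ tri w) (triRoot-pair x y)) (m+n∸m≡n (tri (x + y)) y)

  π₁-pair : ∀ x y → π₁ (pair x y) ≡ x
  π₁-pair x y = trans (cong₂ _∸_ (triRoot-pair x y) (π₂-pair x y)) (m+n∸n≡m x y)

  pair-π : ∀ n → pair (π₁ n) (π₂ n) ≡ n
  pair-π n = trans (cong (λ w → tri w + π₂ n) (m∸n+n≡m π₂≤w)) (m+[n∸m]≡n (proj₁ (triRoot-bounds n)))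
    where
    π₂≤w : π₂ n ≤ triRoot n
    π₂≤w = ≤-trans (∸-monoˡ-≤ (tri (triRoot n)) (≤-pred (proj₂ (triRoot-bounds n))))
                   (≤-reflexive (m+n∸n≡m (triRoot n) (tri (triRoot n))))

  π₂≤ : ∀ n → π₂ n ≤ n
  π₂≤ n = m∸n≤m n (tri (triRoot n))

  π₁≤ : ∀ n → π₁ n ≤ n
  π₁≤ n = ≤-trans (m∸n≤m (triRoot n) (π₂ n)) (≤-trans (n≤tri _) (proj₁ (triRoot-bounds n)))

  -- A nonzero opcode makes an instruction larger than its operand; the induction in `total` rests
  -- on this.
  <pair : ∀ x y → y < pair (suc x) y
  <pair x y = s≤s (m≤n+m y _)

  private
    triF : Fun₁ tri
    triF = fun₁ (recAt (λ k _ → tri k) (λ _ → refl) (λ _ _ → refl) (numC 0) (addC (sucC (var 0F)) (var 1F)) (var 0F))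

    triRootF : Fun₁ triRoot
    triRootF = fun₁ (recAt (λ k _ → triRoot k) (λ _ → refl) (λ _ _ → refl) (numC 0)
      (ifC (ltC (sucC (var 0F)) (app₁ (sucC (var 1F)) triF)) (var 1F) (sucC (var 1F))) (var 0F))

  pairF : Fun₂ pair
  pairF = fun₂ (addC (app₁ (addC (var 0F) (var 1F)) triF) (var 1F))

  π₂F : Fun₁ π₂
  π₂F = fun₁ (subC (var 0F) (app₁ (app₁ (var 0F) triRootF) triF))

  π₁F : Fun₁ π₁
  π₁F = fun₁ (subC (app₁ (var 0F) triRootF) (app₁ (var 0F) π₂F))

-- Iteration and the stack machine

iter : (ℕ → ℕ) → ℕ → ℕ → ℕ
iter f zero    x = x
iter f (suc n) x = f (iter f n x)

iterF : ∀ {f} → Fun₁ f → Fun₂ (iter f)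
iterF {f} F = fun₂ (recAt (λ k xs → iter f k (lookup xs 1F)) (λ _ → refl) (λ _ _ → refl)
  (var 1F) (app₁ (var 1F) F) (var 0F))

iter-suc : ∀ f n x → iter f (suc n) x ≡ iter f n (f x)
iter-suc f zero    x = refl
iter-suc f (suc n) x = cong f (iter-suc f n x)

iter-+ : ∀ f m n x → iter f (m + n) x ≡ iter f m (iter f n x)
iter-+ f zero    n x = refl
iter-+ f (suc m) n x = cong f (iter-+ f m n x)

ifz : ℕ → ℕ → ℕ → ℕ
ifz zero    x y = x
ifz (suc _) x y = y

ifzC : {a b c : Vec ℕ n → ℕ} → Comp a → Comp b → Comp c → Comp (λ xs → ifz (a xs) (b xs) (c xs))
ifzC {a = a} {b} {c} ca cb cc = ext (λ xs → eq (a xs) (b xs) (c xs)) (ifC (eqC ca (numC 0)) cb cc)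
  where
  eq : ∀ k x y → (if k ≡ᵇ 0 then x else y) ≡ ifz k x y
  eq zero    x y = refl
  eq (suc k) x y = refl

-- Instructions are pairs (opcode, operand); opcodes 0–7 stand for v ↦ ⟨a , v⟩, successor, the two projections,
-- v ↦ ⟨v , v⟩, composition, ⟨x , y⟩ ↦ ⟨y , f x⟩ and iteration ⟨n , x⟩ ↦ fⁿ x, as which all larger opcodes count
-- too.  A state pairs a stack of pending instructions with the current value; the empty stack is 0.
push : ℕ → ℕ → ℕ
push c k = suc (pair c k)

exec : ℕ → ℕ → ℕ → ℕ
exec c k v =
  ifz o (pair k (pair a v)) (
  -- Smaller opcodes are excluded by now, so each difference vanishes only for the opcode in
  -- question.
  ifz (o ∸ 1) (pair k (suc v)) (
  ifz (o ∸ 2) (pair k (π₁ v)) (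
  ifz (o ∸ 3) (pair k (π₂ v)) (
  ifz (o ∸ 4) (pair k (pair v v)) (
  ifz (o ∸ 5) (pair (push (π₂ a) (push (π₁ a) k)) v) (
  -- The second component waits as the operand of a pairing instruction, which puts it in front of
  -- the result.
  ifz (o ∸ 6) (pair (push a (push (pair 0 (π₂ v)) k)) (π₁ v)) (
  -- One round of a loop: run the body, attach the decreased counter, repeat the same instruction.
  ifz (π₁ v) (pair k (π₂ v)) (pair (push a (push (pair 0 (π₁ v ∸ 1)) (push c k))) (π₂ v))
  )))))))
  where
  o = π₁ c
  a = π₂ c

-- A state with empty stack is a fixed point; otherwise `∸ 1` undoes the successor in `push`.
step : ℕ → ℕ
step s = ifz (π₁ s) s (exec (π₁ (π₁ s ∸ 1)) (π₂ (π₁ s ∸ 1)) (π₂ s))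

step-push : ∀ c k v → step (pair (push c k) v) ≡ exec c k v
step-push c k v rewrite π₁-pair (push c k) v | π₁-pair c k | π₂-pair c k | π₂-pair (push c k) v = refl

private
  pushC : {a b : Vec ℕ n → ℕ} → Comp a → Comp b → Comp (λ xs → push (a xs) (b xs))
  pushC ca cb = sucC (app₂ ca cb pairF)

execF : Fun₃ exec
execF = fun₃
  (ifzC o (app₂ k (app₂ a v pairF) pairF)
  (ifzC (subC o (numC 1)) (app₂ k (sucC v) pairF)
  (ifzC (subC o (numC 2)) (app₂ k (app₁ v π₁F) pairF)
  (ifzC (subC o (numC 3)) (app₂ k (app₁ v π₂F) pairF)
  (ifzC (subC o (numC 4)) (app₂ k (app₂ v v pairF) pairF)
  (ifzC (subC o (numC 5)) (app₂ (pushC (app₁ a π₂F) (pushC (app₁ a π₁F) k)) v pairF)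
  (ifzC (subC o (numC 6)) (app₂ (pushC a (pushC (app₂ (numC 0) (app₁ v π₂F) pairF) k)) (app₁ v π₁F) pairF)
  (ifzC (app₁ v π₁F) (app₂ k (app₁ v π₂F) pairF)
    (app₂ (pushC a (pushC (app₂ (numC 0) (subC (app₁ v π₁F) (numC 1)) pairF) (pushC c k))) (app₁ v π₂F) pairF)
  ))))))))
  where
  c = var {3} 0F
  k = var {3} 1F
  v = var {3} 2F
  o = app₁ c π₁F
  a = app₁ c π₂F

stepF : Fun₁ step
stepF = fun₁ (ifzC (app₁ s π₁F) s (app₃ (app₁ top π₁F) (app₁ top π₂F) (app₁ s π₂F) execF))
  where
  s = var {1} 0F
  top = subC (app₁ s π₁F) (numC 1)

-- Runs of the machine

_⟶_ : ℕ → ℕ → Set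
s ⟶ s′ = ∃ λ n → iter step n s ≡ s′

⟶-trans : ∀ {s s′ s″} → s ⟶ s′ → s′ ⟶ s″ → s ⟶ s″
⟶-trans {s} (m , p) (n , q) = n + m , trans (iter-+ step n m s) (trans (cong (iter step n) p) q)

-- Quantifying over the rest `k` of the stack makes runs composable.
_∣_↦_ : ℕ → ℕ → ℕ → Set
c ∣ v ↦ r = ∀ k → pair (push c k) v ⟶ pair k r

one-step : ∀ {c k v s} → exec c k v ≡ s → pair (push c k) v ⟶ s
one-step eq = 1 , trans (step-push _ _ _) eq

pairᵢ : ℕ → ℕ
pairᵢ a = pair 0 a

pairᵢ↦ : ∀ a v → pairᵢ a ∣ v ↦ pair a v
pairᵢ↦ a v k = one-step eq
  where
  eq : exec (pairᵢ a) k v ≡ pair k (pair a v)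
  eq rewrite π₁-pair 0 a | π₂-pair 0 a = refl

succ↦ : ∀ a v → pair 1 a ∣ v ↦ suc v
succ↦ a v k = one-step eq
  where
  eq : exec (pair 1 a) k v ≡ pair k (suc v)
  eq rewrite π₁-pair 1 a = refl

π₁↦ : ∀ a v → pair 2 a ∣ v ↦ π₁ v
π₁↦ a v k = one-step eq
  where
  eq : exec (pair 2 a) k v ≡ pair k (π₁ v)
  eq rewrite π₁-pair 2 a = refl

π₂↦ : ∀ a v → pair 3 a ∣ v ↦ π₂ v
π₂↦ a v k = one-step eq
  where
  eq : exec (pair 3 a) k v ≡ pair k (π₂ v)
  eq rewrite π₁-pair 3 a = refl

dup↦ : ∀ a v → pair 4 a ∣ v ↦ pair v v
dup↦ a v k = one-step eq
  where
  eq : exec (pair 4 a) k v ≡ pair k (pair v v)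
  eq rewrite π₁-pair 4 a = refl

comp↦ : ∀ {a u v w} → π₂ a ∣ u ↦ v → π₁ a ∣ v ↦ w → pair 5 a ∣ u ↦ w
comp↦ {a} {u} g f k = ⟶-trans (one-step eq) (⟶-trans (g _) (f k))
  where
  eq : exec (pair 5 a) k u ≡ pair (push (π₂ a) (push (π₁ a) k)) u
  eq rewrite π₁-pair 5 a | π₂-pair 5 a = refl

swap↦ : ∀ {a x y w} → a ∣ x ↦ w → pair 6 a ∣ pair x y ↦ pair y w
swap↦ {a} {x} {y} f k = ⟶-trans (one-step eq) (⟶-trans (f _) (pairᵢ↦ _ _ k))
  where
  eq : exec (pair 6 a) k (pair x y) ≡ pair (push a (push (pairᵢ y) k)) x
  eq rewrite π₁-pair 6 a | π₂-pair 6 a | π₁-pair x y | π₂-pair x y = refl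

-- The loop is described by a trajectory `s`, as no function computed by `a` is available yet. The
-- start `i` varies because the induction on `n` shifts it.
iter↦ : ∀ o {a} (s : ℕ → ℕ) → (∀ i → a ∣ s i ↦ s (suc i)) →
        ∀ n i → pair (7 + o) a ∣ pair n (s i) ↦ s (n + i)
iter↦ o {a} s F zero i k = one-step eq
  where
  eq : exec (pair (7 + o) a) k (pair 0 (s i)) ≡ pair k (s i)
  eq rewrite π₁-pair (7 + o) a | π₁-pair 0 (s i) | π₂-pair 0 (s i) = refl
iter↦ o {a} s F (suc n) i k =
  ⟶-trans (one-step eq) (⟶-trans (F i _) (⟶-trans (pairᵢ↦ n (s (suc i)) _)
    (subst (λ j → pair (push (pair (7 + o) a) k) (pair n (s (suc i))) ⟶ pair k (s j)) (+-suc n i)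
      (iter↦ o s F n (suc i) k))))
  where
  eq : exec (pair (7 + o) a) k (pair (suc n) (s i)) ≡ pair (push a (push (pairᵢ n) (push (pair (7 + o) a) k))) (s i)
  eq rewrite π₁-pair (7 + o) a | π₂-pair (7 + o) a | π₁-pair (suc n) (s i) | π₂-pair (suc n) (s i) = refl

-- Opcodes from 5 on run only smaller codes and, in a loop, the same code with a smaller counter.
-- The induction hypothesis yields the trajectory of a loop one value at a time.
total : ∀ c v → ∃ λ r → c ∣ v ↦ r
total = <-rec _ λ c rec → subst (λ c → ∀ v → ∃ λ r → c ∣ v ↦ r) (pair-π c)
  (go (π₁ c) (π₂ c) λ {b} b< → rec (subst (b <_) (pair-π c) b<))
  where
  go : ∀ o a → (∀ {b} → b < pair o a → ∀ v → ∃ λ r → b ∣ v ↦ r) → ∀ v → ∃ λ r → pair o a ∣ v ↦ r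
  go 0 a rec v = _ , pairᵢ↦ a v
  go 1 a rec v = _ , succ↦ a v
  go 2 a rec v = _ , π₁↦ a v
  go 3 a rec v = _ , π₂↦ a v
  go 4 a rec v = _ , dup↦ a v
  go 5 a rec v with rec (≤-<-trans (π₂≤ a) (<pair 4 a)) v
  ... | w , g with rec (≤-<-trans (π₁≤ a) (<pair 4 a)) w
  ...   | r , f = r , comp↦ g f
  go 6 a rec v with rec (<pair 5 a) (π₁ v)
  ... | w , f = _ , subst (λ u → pair 6 a ∣ u ↦ pair (π₂ v) w) (pair-π v) (swap↦ f)
  go (suc (suc (suc (suc (suc (suc (suc o))))))) a rec v =
    _ , subst (λ u → pair (7 + o) a ∣ u ↦ s (π₁ v + 0)) (pair-π v)
          (iter↦ o s (λ i → proj₂ (rec (<pair (6 + o) a) (s i))) (π₁ v) 0)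
    where
    s : ℕ → ℕ
    s zero    = π₂ v
    s (suc i) = proj₁ (rec (<pair (6 + o) a) (s i))

least : (f : ℕ → ℕ) → ∀ n → f n ≡ 0 → ∃ λ m → f m ≡ 0 × (∀ z → z < m → f z ≢ 0)
least f n fn≡0 with f 0 ≟ 0
... | yes f0≡0 = 0 , f0≡0 , λ _ ()
least f zero    fn≡0 | no f0≢0 = ⊥-elim (f0≢0 fn≡0)
least f (suc n) fn≡0 | no f0≢0 with least (f ∘ suc) n fn≡0
... | m , hit , before = suc m , hit , λ { zero _ → f0≢0 ; (suc z) (s≤s z<m) → before z z<m }

start : ℕ → ℕ → ℕ
start e v = pair (push e 0) v

halting : ∀ e v → ∃ λ m → π₁ (iter step m (start e v)) ≡ 0 × (∀ z → z < m → π₁ (iter step z (start e v)) ≢ 0)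
halting e v with total e v
... | r , run with run 0
...   | n , eq = least (λ i → π₁ (iter step i (start e v))) n (trans (cong π₁ eq) (π₁-pair 0 r))

-- The least halting time comes from the totality proof; `universalF` finds the same number by
-- search.
universal : ℕ → ℕ → ℕ
universal e v = π₂ (iter step (proj₁ (halting e v)) (start e v))

universalF : Fun₂ universal
universalF = fun₂ (app₁ (app₂ time (startC (var 0F) (var 1F)) (iterF stepF)) π₂F)
  where
  startC : {a b : Vec ℕ n → ℕ} → Comp a → Comp b → Comp (λ xs → start (a xs) (b xs))
  startC ca cb = app₂ (sucC (app₂ ca (numC 0) pairF)) cb pairF
  time : Comp {2} (λ xs → proj₁ (halting (lookup xs 0F) (lookup xs 1F)))
  time = minimise _ (λ xs → proj₁ (proj₂ (halting (lookup xs 0F) (lookup xs 1F))))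
    (λ xs → proj₂ (proj₂ (halting (lookup xs 0F) (lookup xs 1F))))
    (app₁ (app₂ (var 0F) (startC (var 1F) (var 2F)) (iterF stepF)) π₁F)

-- The given run may take longer than the least halting time, but halted states no longer change.
universal-correct : ∀ {e v r} → e ∣ v ↦ r → universal e v ≡ r
universal-correct {e} {v} {r} run with halting e v | run 0
... | m , hit , before | n , eq = trans (cong π₂ same) (π₂-pair 0 r)
  where
  m≤n : m ≤ n
  m≤n = ≮⇒≥ λ n<m → before n n<m (trans (cong π₁ eq) (π₁-pair 0 r))
  halted : ∀ k s → π₁ s ≡ 0 → iter step k s ≡ s
  halted zero    s z = refl
  halted (suc k) s z rewrite halted k s z | z = refl
  same : iter step m (start e v) ≡ pair 0 r
  same = trans (sym (halted (n ∸ m) _ hit)) (trans (sym (iter-+ step (n ∸ m) m _))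
           (trans (cong (λ i → iter step i (start e v)) (m∸n+n≡m m≤n)) eq))

-- Compilation of primitive recursive terms

succᵢ fstᵢ sndᵢ dupᵢ idᵢ : ℕ
succᵢ = pair 1 0
fstᵢ  = pair 2 0
sndᵢ  = pair 3 0
dupᵢ  = pair 4 0
idᵢ   = pair 5 (pair fstᵢ dupᵢ)

-- Opcode 6 exchanges the components while applying an instruction to the first, so two uses on ⟨v ,
-- v⟩ give ⟨f v , g v⟩ in the right order.
seq fork : ℕ → ℕ → ℕ
seq f g = pair 5 (pair g f)
fork f g = seq (seq dupᵢ (pair 6 f)) (pair 6 g)

constᵢ : ℕ → ℕ
constᵢ c = seq (pairᵢ c) fstᵢ

seq↦ : ∀ {f g u v w} → f ∣ u ↦ v → g ∣ v ↦ w → seq f g ∣ u ↦ w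
seq↦ {f} {g} {u} {v} {w} F G = comp↦ (subst (_∣ u ↦ v) (sym (π₂-pair g f)) F) (subst (_∣ v ↦ w) (sym (π₁-pair g f)) G)

fork↦ : ∀ {f g v x y} → f ∣ v ↦ x → g ∣ v ↦ y → fork f g ∣ v ↦ pair x y
fork↦ F G = seq↦ (seq↦ (dup↦ 0 _) (swap↦ F)) (swap↦ G)

fst↦ : ∀ x y → fstᵢ ∣ pair x y ↦ x
fst↦ x y = subst (fstᵢ ∣ pair x y ↦_) (π₁-pair x y) (π₁↦ 0 _)

snd↦ : ∀ x y → sndᵢ ∣ pair x y ↦ y
snd↦ x y = subst (sndᵢ ∣ pair x y ↦_) (π₂-pair x y) (π₂↦ 0 _)

const↦ : ∀ c v → constᵢ c ∣ v ↦ c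
const↦ c v = seq↦ (pairᵢ↦ c v) (fst↦ c v)

id↦ : ∀ v → idᵢ ∣ v ↦ v
id↦ v = seq↦ (dup↦ 0 v) (fst↦ v v)

encode : Vec ℕ n → ℕ
encode []       = 0
encode (x ∷ xs) = pair x (encode xs)

mutual
  compile : PR n → ℕ
  compile pzero        = constᵢ 0
  compile psucc        = seq fstᵢ succᵢ
  compile (pproj i)    = compileProj i
  compile (pcomp f gs) = seq (compiles gs) (compile f)
  compile (prec f g)   =
    -- Pairs the number of rounds with the loop state. The state codes the vector of counter, value
    -- and parameters, which is at once the argument list of `g`.
    seq (fork fstᵢ (seq sndᵢ (fork (constᵢ 0) (fork (compile f) idᵢ))))
      (seq (pair 7 (fork (seq fstᵢ succᵢ) (fork (compile g) (seq sndᵢ sndᵢ)))) (seq sndᵢ fstᵢ))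

  compileProj : Fin n → ℕ
  compileProj zero    = fstᵢ
  compileProj (suc i) = seq sndᵢ (compileProj i)

  compiles : ∀ {m} → Vec (PR n) m → ℕ
  compiles []       = constᵢ 0
  compiles (g ∷ gs) = fork (compile g) (compiles gs)

compileProj↦ : ∀ (i : Fin n) xs → compileProj i ∣ encode xs ↦ lookup xs i
compileProj↦ zero    (x ∷ xs) = fst↦ _ _
compileProj↦ (suc i) (x ∷ xs) = seq↦ (snd↦ _ _) (compileProj↦ i xs)

mutual
  compile↦ : ∀ (f : PR n) xs → compile f ∣ encode xs ↦ evalPR f xs
  compile↦ pzero        xs       = const↦ 0 _
  compile↦ psucc        (x ∷ []) = seq↦ (fst↦ _ _) (succ↦ 0 _)
  compile↦ (pproj i)    xs       = compileProj↦ i xs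
  compile↦ (pcomp f gs) xs       = seq↦ (compiles↦ gs xs) (compile↦ f (evalPRs gs xs))
  compile↦ (prec f g)   (n ∷ xs) =
    seq↦ (fork↦ (fst↦ _ _) (seq↦ (snd↦ _ _) (fork↦ (const↦ 0 _) (fork↦ (compile↦ f xs) (id↦ _)))))
      (seq↦ (subst (λ i → pair 7 body ∣ pair n (s 0) ↦ s i) (+-identityʳ n) (iter↦ 0 s body↦ n 0))
        (seq↦ (snd↦ _ _) (fst↦ _ _)))
    where
    body : ℕ
    body = fork (seq fstᵢ succᵢ) (fork (compile g) (seq sndᵢ sndᵢ))
    s : ℕ → ℕ
    s i = encode (i ∷ evalPR (prec f g) (i ∷ xs) ∷ xs)
    body↦ : ∀ i → body ∣ s i ↦ s (suc i)
    body↦ i = fork↦ (seq↦ (fst↦ _ _) (succ↦ 0 _)) (fork↦ (compile↦ g _) (seq↦ (snd↦ _ _) (snd↦ _ _)))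

  compiles↦ : ∀ {m} (gs : Vec (PR n) m) xs → compiles gs ∣ encode xs ↦ encode (evalPRs gs xs)
  compiles↦ []       xs = const↦ 0 _
  compiles↦ (g ∷ gs) xs = fork↦ (compile↦ g xs) (compiles↦ gs xs)

-- The nested pair is `encode` of the two arguments. Every value other than 1 counts as false, so
-- each index gives a relation.
enum : ℕ → BinRel
enum e x y = universal e (pair x (pair y 0)) ≡ᵇ 1

enumR : Rel₃ enum
enumR = rel₃ (eqC (app₂ (var 0F) (app₂ (var 1F) (app₂ (var 2F) (numC 0) pairF) pairF) universalF) (numC 1))

punctual-enum : (S : BinRel) → Punctual S → ∃ λ e → ∀ x y → enum e x y ≡ S x y
punctual-enum S (c , correct) = compile c , λ x y →
  trans (cong (_≡ᵇ 1) (trans (universal-correct (compile↦ c (x ∷ y ∷ []))) (correct x y))) (χ-≡1 (S x y))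
  where
  χ-≡1 : ∀ p → (χ p ≡ᵇ 1) ≡ p
  χ-≡1 true  = refl
  χ-≡1 false = refl

-- The digital search tree of a family of bit strings

-- Stage t owns the labels 3t, 3t + 1 and 3t + 2: its node and its two marks.
data Label : ℕ → Set where
  node  : ∀ t → Label (t * 3)
  mark₁ : ∀ t → Label (1 + t * 3)
  mark₂ : ∀ t → Label (2 + t * 3)

label : ∀ x → Label x
label zero = node 0
label (suc x) with label x
... | node t  = mark₁ t
... | mark₁ t = mark₂ t
... | mark₂ t = node (suc t)

abstract
  -- With `stg`, remainder and quotient modulo 3, by recursions of the shape that `recAt` accepts.
  idx : ℕ → ℕ
  idx zero    = 0
  idx (suc n) = if idx n ≡ᵇ 2 then 0 else suc (idx n)

  stg : ℕ → ℕ
  stg zero    = 0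
  stg (suc n) = if idx n ≡ᵇ 2 then suc (stg n) else stg n

  label-idx-stg : ∀ t → idx (t * 3) ≡ 0 × stg (t * 3) ≡ t
  label-idx-stg zero = refl , refl
  label-idx-stg (suc t) with label-idx-stg t
  ... | p , q rewrite p | q = refl , refl

  idx₀ : ∀ t → idx (t * 3) ≡ 0
  idx₀ t = proj₁ (label-idx-stg t)

  stg₀ : ∀ t → stg (t * 3) ≡ t
  stg₀ t = proj₂ (label-idx-stg t)

  idx₁ : ∀ t → idx (1 + t * 3) ≡ 1
  idx₁ t rewrite idx₀ t = refl

  stg₁ : ∀ t → stg (1 + t * 3) ≡ t
  stg₁ t rewrite idx₀ t = stg₀ t

  idx₂ : ∀ t → idx (2 + t * 3) ≡ 2
  idx₂ t rewrite idx₀ t = refl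

  stg₂ : ∀ t → stg (2 + t * 3) ≡ t
  stg₂ t rewrite idx₀ t = stg₀ t

  label-η : ∀ x → x ≡ idx x + stg x * 3
  label-η x with label x
  ... | node t  rewrite idx₀ t | stg₀ t = refl
  ... | mark₁ t rewrite idx₀ t | stg₀ t = refl
  ... | mark₂ t rewrite idx₀ t | stg₀ t = refl

  idx≤2 : ∀ x → idx x ≤ 2
  idx≤2 x with label x
  ... | node t  rewrite idx₀ t = z≤n
  ... | mark₁ t rewrite idx₀ t = s≤s z≤n
  ... | mark₂ t rewrite idx₀ t = ≤-refl

  label-injective : ∀ {x y} → stg x ≡ stg y → idx x ≡ idx y → x ≡ y
  label-injective {x} {y} p q = trans (label-η x) (trans (cong₂ (λ i t → i + t * 3) q p) (sym (label-η y)))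

  stg<⇒< : ∀ {x k} → stg x < k → x < k * 3
  stg<⇒< {x} {k} lt = subst (_< k * 3) (sym (label-η x))
    (≤-trans (+-monoˡ-≤ (stg x * 3) (s≤s (idx≤2 x))) (*-monoˡ-≤ 3 lt))

  idxF : Fun₁ idx
  idxF = fun₁ (recAt (λ k _ → idx k) (λ _ → refl) (λ _ _ → refl) (numC 0)
    (ifC (eqC (var 1F) (numC 2)) (numC 0) (sucC (var 1F))) (var 0F))

  stgF : Fun₁ stg
  stgF = fun₁ (recAt (λ k _ → stg k) (λ _ → refl) (λ _ _ → refl) (numC 0)
    (ifC (eqC (app₁ (var 0F) idxF) (numC 2)) (sucC (var 1F)) (var 1F)) (var 0F))

module Tree (d : ℕ → ℕ → Bool) where

  -- Here `d i t` is the bit at index `i` of the string of stage `t`.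
  agree : ℕ → ℕ → ℕ → Bool
  agree l s t = all< l (λ i → d i s ≡ᴮ d i t)

  -- h lists, latest first, the depths chosen before stage t, so entry i belongs to stage t ∸ suc i.
  nth : ℕ → ℕ → ℕ
  nth i h = π₁ (iter π₂ i h)

  occupied : ℕ → ℕ → ℕ → Bool
  occupied h t l = any< t (λ i → (nth i h ≡ᵇ l) ∧ agree l (t ∸ suc i) t)

  freeDepth : ℕ → ℕ → ℕ
  -- If all depths below `t` are occupied, the search returns `t`, which is free because earlier
  -- stages have smaller depths.
  freeDepth h t = first t (λ l → not (occupied h t l))

  Agree : ℕ → ℕ → ℕ → Set
  Agree l s t = ∀ i → i < l → d i s ≡ d i t

  agree-true : ∀ {l s t} → agree l s t ≡ true → Agree l s t
  agree-true {l} eq i i<l = ≡ᴮ⇒≡ (all<-true l eq i<l)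

  agree-intro : ∀ {l s t} → Agree l s t → agree l s t ≡ true
  agree-intro {l} h = all<-intro l λ i i<l → ≡⇒≡ᴮ (h i i<l)

  Agree-sym : ∀ {l s t} → Agree l s t → Agree l t s
  Agree-sym h i i<l = sym (h i i<l)

  Agree-trans : ∀ {l s t u} → Agree l s t → Agree l t u → Agree l s u
  Agree-trans h k i i<l = trans (h i i<l) (k i i<l)

  Agree-≤ : ∀ {l l′ s t} → l ≤ l′ → Agree l′ s t → Agree l s t
  Agree-≤ l≤l′ h i i<l = h i (<-≤-trans i<l l≤l′)

  abstract
    history : ℕ → ℕ
    history zero    = 0
    history (suc t) = pair (freeDepth (history t) t) (history t)

    ℓ : ℕ → ℕ
    ℓ t = freeDepth (history t) t

    nth-history : ∀ t i → i < t → nth i (history t) ≡ ℓ (t ∸ suc i)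
    nth-history (suc t) zero    _         = π₁-pair (ℓ t) (history t)
    nth-history (suc t) (suc i) (s≤s i<t) =
      trans (cong π₁ (trans (iter-suc π₂ i _) (cong (iter π₂ i) (π₂-pair (ℓ t) (history t))))) (nth-history t i i<t)

    ℓ≤ : ∀ t → ℓ t ≤ t
    ℓ≤ t = first≤ t _

    ℓ-ancestor : ∀ t {r} → r < ℓ t → ∃ λ s → s < t × ℓ s ≡ r × Agree r s t
    ℓ-ancestor t {r} r<ℓ with any<-true t (not-false (first-before t (λ l → not (occupied (history t) t l)) r<ℓ))
    ... | i , i<t , eq with ∧-true eq
    ...   | p , q = t ∸ suc i , ∸-monoʳ-< z<s i<t , trans (sym (nth-history t i i<t)) (≡ᵇ-true p) , agree-true q

    ℓ-fresh : ∀ {s t} → s < t → ℓ s ≡ ℓ t → ¬ Agree (ℓ t) s t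
    ℓ-fresh {s} {t} s<t eq h with m≤n⇒m<n∨m≡n (ℓ≤ t)
    ... | inj₂ ℓ≡t = <-irrefl (trans eq ℓ≡t) (≤-<-trans (ℓ≤ s) s<t)
    ... | inj₁ ℓ<t = true≢false (any<-intro t i<t (∧-intro (≡ᵇ-intro nth≡) agr)) (not-true free)
      where
      free : not (occupied (history t) t (ℓ t)) ≡ true
      free = first-hit t (λ l → not (occupied (history t) t l)) ℓ<t
      i<t : t ∸ suc s < t
      i<t = ∸-monoʳ-< z<s s<t
      back : t ∸ suc (t ∸ suc s) ≡ s
      back = trans (cong (t ∸_) (sym (+-∸-assoc 1 s<t))) (m∸[m∸n]≡n (<⇒≤ s<t))
      nth≡ : nth (t ∸ suc s) (history t) ≡ ℓ t
      nth≡ = trans (nth-history t (t ∸ suc s) i<t) (trans (cong ℓ back) eq)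
      agr : agree (ℓ t) (t ∸ suc (t ∸ suc s)) t ≡ true
      agr = trans (cong (λ u → agree (ℓ t) u t) back) (agree-intro h)

  -- At the root, where ℓ t = 0, the bit is junk; only its being fixed matters.
  bit : ℕ → Bool
  bit t = d (pred (ℓ t)) t

  -- The later of two stages would have found the prefix taken.
  ℓ-unique : ∀ {s t} → ℓ s ≡ ℓ t → Agree (ℓ t) s t → s ≡ t
  ℓ-unique {s} {t} eq h with <-cmp s t
  ... | tri< s<t _ _ = ⊥-elim (ℓ-fresh s<t eq h)
  ... | tri≈ _ s≡t _ = s≡t
  ... | tri> _ _ t<s = ⊥-elim (ℓ-fresh t<s (sym eq) (Agree-sym (subst (λ l → Agree l s t) (sym eq) h)))

  ℓ-ancestor≤ : ∀ t {r} → r ≤ ℓ t → ∃ λ s → s ≤ t × ℓ s ≡ r × Agree r s t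
  ℓ-ancestor≤ t r≤ℓ with m≤n⇒m<n∨m≡n r≤ℓ
  ... | inj₂ r≡ℓ = t , ≤-refl , sym r≡ℓ , λ _ _ → refl
  ... | inj₁ r<ℓ with ℓ-ancestor t r<ℓ
  ...   | s , s<t , p , q = s , <⇒≤ s<t , p , q

  -- The order of the tree

  data Le (x y : ℕ) : Set where
    same  : x ≡ y → Le x y
    -- This includes a node above its own marks.
    above : idx y ≡ 0 → ℓ (stg y) ≤ ℓ (stg x) → Agree (ℓ (stg y)) (stg y) (stg x) → Le x y
    -- Bit 0 shows as a chain; for bit 1 both marks hang directly below the node.
    chain : stg y ≡ stg x → idx y ≡ 1 → idx x ≡ 2 → bit (stg x) ≡ false → Le x y

  abstract
    R : BinRel
    R x y = (x ≡ᵇ y)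
          ∨ (((idx y ≡ᵇ 0) ∧ (ℓ (stg y) <ᵇ suc (ℓ (stg x))) ∧ agree (ℓ (stg y)) (stg y) (stg x))
          ∨ ((stg y ≡ᵇ stg x) ∧ (idx y ≡ᵇ 1) ∧ (idx x ≡ᵇ 2) ∧ not (bit (stg x))))

    R⇒Le : ∀ {x y} → R x y ≡ true → Le x y
    R⇒Le eq with ∨-true eq
    ... | inj₁ p = same (≡ᵇ-true p)
    ... | inj₂ eq′ with ∨-true eq′
    ...   | inj₁ p = let a , p′ = ∧-true p ; b , c = ∧-true p′ in
                     above (≡ᵇ-true a) (≤-pred (<ᵇ-true b)) (agree-true c)
    ...   | inj₂ p = let a , p′ = ∧-true p ; b , p″ = ∧-true p′ ; c , e = ∧-true p″ in
                     chain (≡ᵇ-true a) (≡ᵇ-true b) (≡ᵇ-true c) (not-true e)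

    Le⇒R : ∀ {x y} → Le x y → R x y ≡ true
    Le⇒R {x} {y} (same p) rewrite ≡ᵇ-intro p = refl
    Le⇒R {x} {y} (above a b c) = ∨-introʳ (x ≡ᵇ y)
      (∨-introˡ _ (∧-intro (≡ᵇ-intro a) (∧-intro (<ᵇ-intro (s≤s b)) (agree-intro c))))
    Le⇒R {x} {y} (chain a b c e) = ∨-introʳ (x ≡ᵇ y) (∨-introʳ _
      (∧-intro (≡ᵇ-intro a) (∧-intro (≡ᵇ-intro b) (∧-intro (≡ᵇ-intro c) (cong not e)))))

  Le-trans : ∀ {x y z} → Le x y → Le y z → Le x z
  Le-trans (same refl) q = q
  Le-trans p (same refl) = p
  Le-trans (above a b c) (above a′ b′ c′) = above a′ (≤-trans b′ b) (Agree-trans c′ (Agree-≤ b′ c))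
  Le-trans (above a b c) (chain _ _ i₂ _) with trans (sym a) i₂
  ... | ()
  Le-trans {x} {y} {z} (chain s _ _ _) (above a b c) =
    above a (subst (λ t → ℓ (stg z) ≤ ℓ t) s b) (subst (Agree _ (stg z)) s c)
  Le-trans (chain _ i₁ _ _) (chain _ _ i₂ _) with trans (sym i₁) i₂
  ... | ()

  -- Ranks and the tree axioms

  abstract
    extra : ℕ → Bool → ℕ
    extra 0             _     = 0
    extra 1             _     = 1
    extra (suc (suc _)) true  = 1
    extra (suc (suc _)) false = 2

    -- The number of elements strictly above, as a closed formula; `Le-strict`, `Le-unique` and
    -- `Le-ancestor` justify this reading.
    rank : ℕ → ℕ
    rank x = ℓ (stg x) + extra (idx x) (bit (stg x))

    rank-node : ∀ {x} → idx x ≡ 0 → rank x ≡ ℓ (stg x)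
    rank-node {x} p rewrite p = +-identityʳ _

    rank-mark₁ : ∀ {x} → idx x ≡ 1 → rank x ≡ suc (ℓ (stg x))
    rank-mark₁ {x} p rewrite p = +-comm _ 1

    rank-fork : ∀ {x} → idx x ≡ 2 → bit (stg x) ≡ true → rank x ≡ suc (ℓ (stg x))
    rank-fork {x} p q rewrite p | q = +-comm _ 1

    rank-chain : ∀ {x} → idx x ≡ 2 → bit (stg x) ≡ false → rank x ≡ suc (suc (ℓ (stg x)))
    rank-chain {x} p q rewrite p | q = +-comm _ 2

    ℓ≤rank : ∀ x → ℓ (stg x) ≤ rank x
    ℓ≤rank x = m≤m+n _ _

  data RankView (x : ℕ) : Set where
    atNode : idx x ≡ 0 → rank x ≡ ℓ (stg x) → RankView x
    low    : rank x ≡ suc (ℓ (stg x)) → RankView x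
    high   : idx x ≡ 2 → bit (stg x) ≡ false → rank x ≡ suc (suc (ℓ (stg x))) → RankView x

  rankView : ∀ x → RankView x
  rankView x with idx x in ix | idx≤2 x | bit (stg x) in bx
  ... | 0 | _ | _     = atNode ix (rank-node ix)
  ... | 1 | _ | _     = low (rank-mark₁ ix)
  ... | 2 | _ | true  = low (rank-fork ix bx)
  ... | 2 | _ | false = high ix bx (rank-chain ix bx)
  ... | suc (suc (suc _)) | s≤s (s≤s ()) | _

  Le-strict : ∀ {x y} → Le x y → y ≡ x ⊎ rank y < rank x
  Le-strict (same p) = inj₁ (sym p)
  Le-strict {x} {y} (above a b c) with m≤n⇒m<n∨m≡n b
  ... | inj₁ lt = inj₂ (subst (_< rank x) (sym (rank-node a)) (<-≤-trans lt (ℓ≤rank x)))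
  -- With equal depths `y` is the node of the stage of `x`, so it is `x` itself or `x` is one of its
  -- marks.
  ... | inj₂ eq with rankView x
  ...   | atNode ix _ = inj₁ (label-injective (ℓ-unique eq (subst (λ l → Agree l _ _) eq c)) (trans a (sym ix)))
  ...   | low r       = inj₂ (subst₂ _<_ (sym (trans (rank-node a) eq)) (sym r) ≤-refl)
  ...   | high _ _ r  = inj₂ (subst₂ _<_ (sym (trans (rank-node a) eq)) (sym r) (n≤1+n _))
  Le-strict {x} {y} (chain s i₁ i₂ f) = inj₂ (subst₂ _<_
    (sym (trans (rank-mark₁ i₁) (cong (suc ∘ ℓ) s))) (sym (rank-chain i₂ f)) ≤-refl)

  Le-rank : ∀ {x y} → Le x y → rank y ≤ rank x
  Le-rank p with Le-strict p
  ... | inj₁ refl = ≤-refl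
  ... | inj₂ lt   = <⇒≤ lt

  -- A node above `x` is a prefix of its string, hence fixed by its length. The upper mark of a
  -- chain has a rank exceeding the depth of the stage, which no node above `x` attains.
  Le-unique : ∀ {x y z} → Le x y → Le x z → rank y ≡ rank z → y ≡ z
  Le-unique p q eq with Le-strict p | Le-strict q
  ... | inj₁ refl | inj₁ refl = refl
  ... | inj₁ refl | inj₂ lt = ⊥-elim (<-irrefl (sym eq) lt)
  ... | inj₂ lt | inj₁ refl = ⊥-elim (<-irrefl eq lt)
  Le-unique (same refl) q eq | inj₂ lt | inj₂ _ = ⊥-elim (<-irrefl refl lt)
  Le-unique p (same refl) eq | inj₂ _ | inj₂ lt = ⊥-elim (<-irrefl refl lt)
  Le-unique {x} {y} {z} (above a b c) (above a′ b′ c′) eq | _ | _ =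
    label-injective (ℓ-unique ℓ≡ (Agree-trans (subst (λ l → Agree l _ _) ℓ≡ c) (Agree-sym c′))) (trans a (sym a′))
    where
    ℓ≡ : ℓ (stg y) ≡ ℓ (stg z)
    ℓ≡ = trans (sym (rank-node a)) (trans eq (rank-node a′))
  Le-unique (above a b c) (chain s i₁ _ _) eq | _ | _ =
    ⊥-elim (<-irrefl (trans (sym (rank-node a)) (trans eq (trans (rank-mark₁ i₁) (cong (suc ∘ ℓ) s)))) (s≤s b))
  Le-unique (chain s i₁ _ _) (above a b c) eq | _ | _ =
    ⊥-elim (<-irrefl (trans (sym (rank-node a)) (trans (sym eq) (trans (rank-mark₁ i₁) (cong (suc ∘ ℓ) s)))) (s≤s b))
  Le-unique (chain s i₁ _ _) (chain s′ i₁′ _ _) eq | _ | _ =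
    label-injective (trans s (sym s′)) (trans i₁ (sym i₁′))

  Le-node : ∀ {x s} → ℓ s ≤ ℓ (stg x) → Agree (ℓ s) s (stg x) → Le x (s * 3)
  Le-node {x} {s} b c = above (idx₀ s) (subst (λ u → ℓ u ≤ ℓ (stg x)) (sym (stg₀ s)) b)
    (subst (λ u → Agree (ℓ u) u (stg x)) (sym (stg₀ s)) c)

  rank-label : ∀ s → rank (s * 3) ≡ ℓ s
  rank-label s = trans (rank-node (idx₀ s)) (cong ℓ (stg₀ s))

  Le-ancestor-node : ∀ x {r} → r ≤ ℓ (stg x) →
    ∃ λ s → ℓ s ≡ r × Agree r s (stg x) × Le x (s * 3) × rank (s * 3) ≡ r
  Le-ancestor-node x r≤ℓ with ℓ-ancestor≤ (stg x) r≤ℓ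
  ... | s , _ , refl , agr = s , refl , agr , Le-node r≤ℓ agr , rank-label s

  Le-ancestor : ∀ x {r} → r ≤ rank x → ∃ λ y → Le x y × rank y ≡ r
  Le-ancestor x {r} r≤ with r ≤? ℓ (stg x)
  ... | yes r≤ℓ = let s , _ , _ , p , q = Le-ancestor-node x r≤ℓ in s * 3 , p , q
  ... | no r≰ℓ with m≤n⇒m<n∨m≡n r≤
  ...   | inj₂ eq = x , same refl , sym eq
  ...   | inj₁ r< with rankView x
  ...     | atNode _ eq = ⊥-elim (r≰ℓ (≤-trans r≤ (≤-reflexive eq)))
  ...     | low eq      = ⊥-elim (r≰ℓ (≤-pred (subst (r <_) eq r<)))
  ...     | high ix bx eq = 1 + stg x * 3 , chain (stg₁ _) (idx₁ (stg x)) ix bx ,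
    trans (rank-mark₁ (idx₁ (stg x))) (trans (cong (suc ∘ ℓ) (stg₁ _))
      (≤-antisym (≰⇒> r≰ℓ) (≤-pred (subst (r <_) eq r<))))

  -- The element above `y` with the rank of `z` is also above `x`, so it is `z`.
  Le-linear : ∀ {x y z} → Le x y → Le x z → rank z ≤ rank y → Le y z
  Le-linear {x} {y} p q le with Le-ancestor y le
  ... | w , y≤w , eq = subst (Le y) (Le-unique (Le-trans p y≤w) q eq) y≤w

  -- Ancestors are inserted earlier. This makes the cones finite.
  Le⇒≥ : ∀ {x y} → Le x y → y ≤ x
  Le⇒≥ (same refl) = ≤-refl
  Le⇒≥ {x} {y} (above a b c) with ℓ-ancestor≤ (stg x) b
  ... | s , s≤ , p , q = subst₂ _≤_ (sym (trans (label-η y) (cong₂ (λ i t → i + t * 3) a (sym s≡)))) (sym (label-η x))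
          (≤-trans (*-monoˡ-≤ 3 s≤) (m≤n+m _ (idx x)))
    where
    s≡ : s ≡ stg y
    s≡ = ℓ-unique p (Agree-trans q (Agree-sym c))
  Le⇒≥ {x} {y} (chain s i₁ i₂ _) = subst₂ _≤_ (sym (label-η y)) (sym (label-η x))
    (+-mono-≤ (subst₂ _≤_ (sym i₁) (sym i₂) (s≤s z≤n)) (≤-reflexive (cong (_* 3) s)))

  isPosetTree : IsPosetTree R
  isPosetTree = record
    { refl       = λ x → Le⇒R (same refl)
    ; antisym    = λ x y p q → Le-unique (same refl) (R⇒Le p) (≤-antisym (Le-rank (R⇒Le q)) (Le-rank (R⇒Le p)))
    ; trans      = λ x y z p q → Le⇒R (Le-trans (R⇒Le {x} {y} p) (R⇒Le {y} {z} q))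
    ; root       = 0
    ; greatest   = λ x → Le⇒R (Le-node {x} {0} (≤-trans (ℓ≤ 0) z≤n) λ i i< → ⊥-elim (n≮0 (<-≤-trans i< (ℓ≤ 0))))
    ; coneLinear = linear
    ; coneFinite = λ x → upTo (suc x) , λ y p → ∈-upTo⁺ (s≤s (Le⇒≥ (R⇒Le p)))
    }
    where
    linear : ∀ x y z → R x y ≡ true → R x z ≡ true → R y z ≡ true ⊎ R z y ≡ true
    linear x y z p q with ≤-total (rank z) (rank y)
    ... | inj₁ le = inj₁ (Le⇒R (Le-linear (R⇒Le p) (R⇒Le q) le))
    ... | inj₂ le = inj₂ (Le⇒R (Le-linear (R⇒Le q) (R⇒Le p) le))

  -- Reading a bit off the order

  Leaf : ℕ → Set
  Leaf x = ∀ u → Le u x → u ≡ x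

  mark₁≤node : ∀ t → Le (1 + t * 3) (t * 3)
  mark₁≤node t = Le-node (≤-reflexive (cong ℓ (sym (stg₁ t)))) λ i _ → cong (d i) (sym (stg₁ t))

  mark₂≤mark₁ : ∀ t → bit t ≡ false → Le (2 + t * 3) (1 + t * 3)
  mark₂≤mark₁ t bt = chain (trans (stg₁ t) (sym (stg₂ t))) (idx₁ t) (idx₂ t) (trans (cong bit (stg₂ t)) bt)

  mark₁-leaf : ∀ t → bit t ≡ true → Leaf (1 + t * 3)
  mark₁-leaf t bt u (same p) = p
  mark₁-leaf t bt u (above a _ _) with trans (sym (idx₁ t)) a
  ... | ()
  mark₁-leaf t bt u (chain s _ _ bu) = ⊥-elim (true≢false (trans (cong bit (trans (sym s) (stg₁ t))) bt) bu)

  mark₂-leaf : ∀ t → Leaf (2 + t * 3)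
  mark₂-leaf t u (same p) = p
  mark₂-leaf t u (above a _ _) with trans (sym (idx₂ t)) a
  ... | ()
  mark₂-leaf t u (chain _ i₁ _ _) with trans (sym (idx₂ t)) i₁
  ... | ()

  -- A non-leaf has a witness at a known place, the next label, so that a finite part of `S` can
  -- settle the question.
  leaf⊎suc : ∀ x → Leaf x ⊎ Le (suc x) x
  leaf⊎suc x with label x
  ... | node t  = inj₂ (mark₁≤node t)
  ... | mark₂ t = inj₁ (mark₂-leaf t)
  ... | mark₁ t with bit t in bt
  ...   | true  = inj₁ (mark₁-leaf t bt)
  ...   | false = inj₂ (mark₂≤mark₁ t bt)

  -- A node of rank e + 1 has a leaf child exactly if its bit is 1: other nodes have marks below them, and the upper
  -- mark of a chain has the lower one.
  LeafChild : ℕ → ℕ → Set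
  LeafChild e q = ∃ λ w → Le w q × rank w ≡ 2 + e × Leaf w

  -- Stated by order and rank alone, so that an isomorphism can carry it over.
  ZeroSide : ℕ → ℕ → Set
  ZeroSide e x = ∃ λ q → Le x q × x ≢ q × rank q ≡ suc e × ¬ LeafChild e q

  -- The element `q` is not the upper mark of a chain, as the lower mark would be a leaf child. As a
  -- node it has bit `e` of `x` as its last bit, and a 1 would put a leaf directly below it.
  zeroSide⇒ : ∀ {e x} → ZeroSide e x → d e (stg x) ≡ false
  zeroSide⇒ (q , same p , x≢q , _) = ⊥-elim (x≢q p)
  zeroSide⇒ {e} {x} (q , chain s i₁ i₂ bx , _ , rq , noLeaf) = ⊥-elim (noLeaf (x , chain s i₁ i₂ bx ,
    trans (rank-chain i₂ bx) (cong suc (trans (cong (suc ∘ ℓ) (sym s)) (trans (sym (rank-mark₁ i₁)) rq))) ,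
    subst Leaf (sym (trans (label-η x) (cong (_+ stg x * 3) i₂))) (mark₂-leaf (stg x))))
  zeroSide⇒ {e} {x} (q , above a b c , _ , rq , noLeaf) with d e (stg x) in dx
  ... | false = refl
  ... | true  = ⊥-elim (noLeaf (1 + stg q * 3 , subst (Le _) (sym q≡) (mark₁≤node (stg q)) ,
      trans (rank-mark₁ (idx₁ (stg q))) (cong suc (trans (cong ℓ (stg₁ (stg q))) ℓq)) ,
      mark₁-leaf (stg q) bq))
    where
    q≡ : q ≡ stg q * 3
    q≡ = trans (label-η q) (cong (_+ stg q * 3) a)
    ℓq : ℓ (stg q) ≡ suc e
    ℓq = trans (sym (rank-node a)) rq
    bq : bit (stg q) ≡ true
    bq = trans (cong (λ l → d (pred l) (stg q)) ℓq) (trans (c e (subst (e <_) (sym ℓq) ≤-refl)) dx)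

  ⇒zeroSide : ∀ {e x} → d e (stg x) ≡ false → 2 + e ≤ ℓ (stg x) → ZeroSide e x
  ⇒zeroSide {e} {x} dx deep with Le-ancestor-node x (≤-trans (n≤1+n _) deep)
  ... | s , ℓs , agr , x≤q , rq = s * 3 , x≤q , x≢q , rq , noLeaf
    where
    x≢q : x ≢ s * 3
    x≢q refl = <-irrefl (sym rq) (≤-trans deep (ℓ≤rank x))
    bs : bit s ≡ false
    bs = trans (cong (λ l → d (pred l) s) ℓs) (trans (agr e ≤-refl) dx)
    s≡ : ∀ {w u} → ℓ u ≡ suc e → stg w ≡ u → Agree (ℓ (stg (s * 3))) (stg (s * 3)) (stg w) → s ≡ u
    s≡ {w} ℓu refl c = ℓ-unique (trans ℓs (sym ℓu))
      (subst₂ (λ l v → Agree l v (stg w)) (trans (cong ℓ (stg₀ s)) (trans ℓs (sym ℓu))) (stg₀ s) c)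
    noLeaf : ¬ LeafChild e (s * 3)
    noLeaf (w , same refl , rw , _) = <-irrefl (trans (sym rq) rw) ≤-refl
    noLeaf (w , chain _ i₁ _ _ , _) with trans (sym (idx₀ s)) i₁
    ... | ()
    -- Nodes are no leaves. A mark directly below its node would belong to `s`, whose marks form a
    -- chain with a non-leaf on top. The lower mark of a chain would belong to a stage of depth `e`,
    -- too shallow to lie below `s`.
    noLeaf (w , above a b c , rw , leaf) with label w
    ... | node u = 1+n≢n (leaf _ (mark₁≤node u))
    ... | mark₁ u with s≡ {1 + u * 3} (suc-injective (trans (sym (trans (rank-mark₁ (idx₁ u)) (cong (suc ∘ ℓ) (stg₁ u)))) rw)) (stg₁ u) c
    ...   | refl = 1+n≢n (leaf _ (mark₂≤mark₁ s bs))
    noLeaf (w , above a b c , rw , leaf) | mark₂ u with bit u in bu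
    ... | true with s≡ {2 + u * 3} (suc-injective (trans (sym (trans (rank-fork (idx₂ u) (trans (cong bit (stg₂ u)) bu)) (cong (suc ∘ ℓ) (stg₂ u)))) rw)) (stg₂ u) c
    ...   | refl = true≢false bu bs
    noLeaf (w , above a b c , rw , leaf) | mark₂ u | false = <-irrefl refl
      (≤-trans (≤-reflexive (sym (trans (cong ℓ (stg₀ s)) ℓs))) (≤-trans b (≤-reflexive
        (suc-injective (suc-injective (trans (sym (rank-chain (idx₂ u) (trans (cong bit (stg₂ u)) bu))) rw))))))

  -- Each prefix has two extensions, so there are finitely many of each length. Whether an extension
  -- is ever occupied is left undecided, hence the double negation.
  ℓ-bounded : ∀ m → ¬ ¬ (∃ λ M → ∀ t → ℓ t ≤ m → t < M)
  ℓ-bounded zero k = k (1 , λ t ℓt → s≤s (≤-reflexive (ℓ-unique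
    (trans (n≤0⇒n≡0 ℓt) (sym (n≤0⇒n≡0 (ℓ≤ 0)))) λ i i< → ⊥-elim (n≮0 (<-≤-trans i< (ℓ≤ 0))))))
  ℓ-bounded (suc m) k = ℓ-bounded m λ (M , below) →
    ¬¬-bounded-choice M (λ s B → ∀ t → ℓ t ≡ suc m → Agree m s t → t < B) (λ B≤B′ p t ℓt agr → <-≤-trans (p t ℓt agr) B≤B′)
      both λ (B , next) → k (M ⊔ B , λ t ℓt≤ → bound M B below next t (m≤n⇒m<n∨m≡n ℓt≤))
    where
    extension : ∀ s c → ¬ ¬ (∃ λ B → ∀ t → ℓ t ≡ suc m → Agree m s t → d m t ≡ c → t < B)
    -- The bound 0 is tried first; a counterexample `t` is the only stage with its prefix, so then
    -- `suc t` is a bound.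
    extension s c k = k (0 , λ t ℓt agr dt → ⊥-elim (k (suc t , λ t′ ℓt′ agr′ dt′ →
      s≤s (≤-reflexive (ℓ-unique (trans ℓt′ (sym ℓt)) (agreement ℓt agr agr′ dt dt′))))))
      where
      agreement : ∀ {t t′} → ℓ t ≡ suc m → Agree m s t → Agree m s t′ → d m t ≡ c → d m t′ ≡ c → Agree (ℓ t) t′ t
      agreement ℓt agr agr′ dt dt′ i i< with m≤n⇒m<n∨m≡n (≤-pred (subst (i <_) ℓt i<))
      ... | inj₁ i<m  = trans (sym (agr′ i i<m)) (agr i i<m)
      ... | inj₂ refl = trans dt′ (sym dt)
    both : ∀ s → ¬ ¬ (∃ λ B → ∀ t → ℓ t ≡ suc m → Agree m s t → t < B)
    both s k = extension s true λ (B , p) → extension s false λ (B′ , p′) → k (B ⊔ B′ , λ t ℓt agr → pick B B′ p p′ t ℓt agr (d m t) refl)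
      where
      pick : ∀ B B′ → (∀ t → ℓ t ≡ suc m → Agree m s t → d m t ≡ true → t < B) →
             (∀ t → ℓ t ≡ suc m → Agree m s t → d m t ≡ false → t < B′) →
             ∀ t → ℓ t ≡ suc m → Agree m s t → ∀ c → d m t ≡ c → t < B ⊔ B′
      pick B B′ p p′ t ℓt agr true  dt = <-≤-trans (p t ℓt agr dt) (m≤m⊔n B B′)
      pick B B′ p p′ t ℓt agr false dt = <-≤-trans (p′ t ℓt agr dt) (m≤n⊔m B B′)
    bound : ∀ M B → (∀ t → ℓ t ≤ m → t < M) → (∀ s → s < M → ∀ t → ℓ t ≡ suc m → Agree m s t → t < B) →
            ∀ t → ℓ t < suc m ⊎ ℓ t ≡ suc m → t < M ⊔ B
    bound M B below next t (inj₁ lt) = <-≤-trans (below t (≤-pred lt)) (m≤m⊔n M B)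
    bound M B below next t (inj₂ eq) with ℓ-ancestor t (subst (m <_) (sym eq) ≤-refl)
    ... | s , _ , ℓs , agr = <-≤-trans (next s (below s (≤-reflexive ℓs)) t eq agr) (m≤n⊔m M B)

  -- Computability of the tree

  module _ (dR : Rel₂ d) where
    agreeR : Rel₃ agree
    agreeR = rel₃ (allC (var 0F) (eqBC (appB₂ (var 0F) (var 2F) dR) (appB₂ (var 0F) (var 3F) dR)))

    nthF : Fun₂ nth
    nthF = fun₂ (app₁ (app₂ (var 0F) (var 1F) (iterF π₂F)) π₁F)

    occupiedR : Rel₃ occupied
    occupiedR = rel₃ (anyC (var 1F) (andC (eqC (app₂ (var 0F) (var 1F) nthF) (var 3F))
      (appB₃ (var 3F) (subC (var 2F) (sucC (var 0F))) (var 2F) agreeR)))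

    freeDepthF : Fun₂ freeDepth
    freeDepthF = fun₂ (firstC (var 1F) (notC (appB₃ (var 1F) (var 2F) (var 0F) occupiedR)))

    abstract
      historyF : Fun₁ history
      historyF = fun₁ (recAt (λ k _ → history k) (λ _ → refl) (λ _ _ → refl) (numC 0)
        (app₂ (app₂ (var 1F) (var 0F) freeDepthF) (var 1F) pairF) (var 0F))

      ℓF : Fun₁ ℓ
      ℓF = fun₁ (app₂ (app₁ (var 0F) historyF) (var 0F) freeDepthF)

      R-computable : Computable R
      R-computable = Comp.prog c , λ x y → Comp.runs c (x ∷ y ∷ [])
        where
        sx : Comp {2} (λ xs → stg (lookup xs 0F))
        sx = app₁ (var 0F) stgF
        sy : Comp {2} (λ xs → stg (lookup xs 1F))
        sy = app₁ (var 1F) stgF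
        ℓx : Comp {2} (λ xs → ℓ (stg (lookup xs 0F)))
        ℓx = app₁ sx ℓF
        ℓy : Comp {2} (λ xs → ℓ (stg (lookup xs 1F)))
        ℓy = app₁ sy ℓF
        c : Comp {2} (λ xs → χ (R (lookup xs 0F) (lookup xs 1F)))
        c = CompB.char (orC (eqC (var 0F) (var 1F)) (orC
          (andC (eqC (app₁ (var 1F) idxF) (numC 0)) (andC (ltC ℓy (sucC ℓx)) (appB₃ ℓy sy sx agreeR)))
          (andC (eqC sy sx) (andC (eqC (app₁ (var 1F) idxF) (numC 1)) (andC (eqC (app₁ (var 0F) idxF) (numC 2))
            (notC (appB₂ (predC ℓx) sx dR)))))))

-- Choice of the bits

module Diagonal (S : ℕ → BinRel) where

  -- Here rank + 1, Leaf, LeafChild and ZeroSide are read off from the restriction of S e to the labels below N.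
  up : ℕ → ℕ → ℕ → ℕ
  up e N z = count N (λ u → S e z u)

  leafIn : ℕ → ℕ → ℕ → Bool
  leafIn e N w = all< N (λ u → not (S e u w) ∨ (u ≡ᵇ w))

  leafChild : ℕ → ℕ → ℕ → Bool
  leafChild e N q = any< N (λ w → S e w q ∧ (up e N w ≡ᵇ 3 + e) ∧ leafIn e N w)

  zeroSide : ℕ → ℕ → ℕ → Bool
  zeroSide e N z = any< N (λ q → S e z q ∧ not (z ≡ᵇ q) ∧ (up e N q ≡ᵇ 2 + e) ∧ not (leafChild e N q))

  size : ℕ → ℕ → ℕ
  size e N = count N (λ z → zeroSide e N z)

  -- The first `b` stages own `b * 3` labels. Looking at `t * 4` elements of `S`, more than the
  -- first `t` stages own, is what forces an excess in `impossible`.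
  excess : ℕ → ℕ → ℕ → Bool
  excess e t b = b * 3 <ᵇ size e (t * 4)

  -- One more than the last stage before t at which bit e was 0, so that 3 · lastZero e t bounds the size of the
  -- 0-side in the tree.
  lastZero : ℕ → ℕ → ℕ
  lastZero e zero    = 0
  lastZero e (suc t) = if excess e t (lastZero e t) then lastZero e t else suc t

  d : ℕ → ℕ → Bool
  d e t = excess e t (lastZero e t)

  open Tree d

  lastZero≤ : ∀ e t → lastZero e t ≤ t
  lastZero≤ e zero = z≤n
  lastZero≤ e (suc t) with d e t
  ... | true  = m≤n⇒m≤1+n (lastZero≤ e t)
  ... | false = ≤-refl

  <lastZero : ∀ e {s} t → d e s ≡ false → s < t → s < lastZero e t
  <lastZero e {s} (suc t) ds s<1+t with d e t in dt
  ... | false = s<1+t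
  ... | true with m≤n⇒m<n∨m≡n (≤-pred s<1+t)
  ...   | inj₁ s<t  = <lastZero e t ds s<t
  ...   | inj₂ refl = ⊥-elim (true≢false dt ds)

  -- Comparison with an isomorphic structure

  module _ (e : ℕ) (iso : Isomorphic R (S e)) where
    private
      φ ψ : ℕ → ℕ
      φ = Bijection.to (proj₁ iso)
      ψ z = proj₁ (Bijection.surjective (proj₁ iso) z)

      φψ : ∀ z → φ (ψ z) ≡ z
      φψ z = proj₂ (Bijection.surjective (proj₁ iso) z) refl

      ψφ : ∀ x → ψ (φ x) ≡ x
      ψφ x = Bijection.injective (proj₁ iso) (φψ (φ x))

      ψ-injective : ∀ {z u} → ψ z ≡ ψ u → z ≡ u
      ψ-injective {z} {u} eq = trans (sym (φψ z)) (trans (cong φ eq) (φψ u))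

      S⇒Le : ∀ z u → S e z u ≡ true → Le (ψ z) (ψ u)
      S⇒Le z u p = R⇒Le (proj₂ (proj₂ iso (ψ z) (ψ u)) (trans (cong₂ (S e) (φψ z) (φψ u)) p))

      Le⇒S : ∀ z x → Le (ψ z) x → S e z (φ x) ≡ true
      Le⇒S z x p = trans (cong (λ v → S e v (φ x)) (sym (φψ z))) (proj₁ (proj₂ iso (ψ z) x) (Le⇒R p))

      Le⇒S′ : ∀ x u → Le x (ψ u) → S e (φ x) u ≡ true
      Le⇒S′ x u p = trans (cong (S e (φ x)) (sym (φψ u))) (proj₁ (proj₂ iso x (ψ u)) (Le⇒R p))

    -- Below `N₀` lie the images of all elements of rank at most `3 + e` and, for the sake of the
    -- leaf test, those of their successor labels.
    module Stable (N₀ : ℕ) (early : ∀ x → rank x ≤ 3 + e → φ x < N₀ × φ (suc x) < N₀) where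

      module _ {N : ℕ} (N₀≤N : N₀ ≤ N) where

        -- Different elements above `z` have different ranks.
        up≤ : ∀ z → up e N z ≤ suc (rank (ψ z))
        up≤ z = count≤ N (suc (rank (ψ z))) (λ u r → Le (ψ z) (ψ u) × rank (ψ u) ≡ r)
          (λ (p , r) (p′ , r′) → ψ-injective (Le-unique p p′ (trans r (sym r′))))
          λ u _ Szu → let p = S⇒Le z u Szu in rank (ψ u) , s≤s (Le-rank p) , p , refl

        ≤up : ∀ z k → k ≤ suc (rank (ψ z)) → k ≤ 4 + e → k ≤ up e N z
        ≤up z k k≤r k≤e = ≤count k N (λ r u → rank (ψ u) ≡ r) (λ r r′ → trans (sym r) r′) λ r r<k →
          let x , p , rx = Le-ancestor (ψ z) (≤-pred (≤-trans r<k k≤r)) in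
          φ x , <-≤-trans (proj₁ (early x (subst (_≤ 3 + e) (sym rx) (≤-pred (≤-trans r<k k≤e))))) N₀≤N ,
          Le⇒S z x p , trans (cong rank (ψφ x)) rx

        up⇒rank : ∀ z k → k ≤ 2 + e → up e N z ≡ suc k → rank (ψ z) ≡ k
        up⇒rank z k k≤ eq = ≤-antisym
          -- A rank above `k` would already show `k + 2` elements, of ranks up to `3 + e`; this is
          -- why `early` goes one rank beyond `2 + e`.
          (≮⇒≥ λ k<r → <-irrefl (sym eq) (≤up z (2 + k) (s≤s k<r) (s≤s (s≤s k≤))))
          (≤-pred (subst (_≤ suc (rank (ψ z))) eq (up≤ z)))

        rank⇒up : ∀ z k → k ≤ 2 + e → rank (ψ z) ≡ k → up e N z ≡ suc k
        rank⇒up z k k≤ refl = ≤-antisym (up≤ z) (≤up z (suc k) ≤-refl (s≤s (m≤n⇒m≤1+n k≤)))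

        leafIn⇒ : ∀ w → rank (ψ w) ≡ 2 + e → leafIn e N w ≡ true → Leaf (ψ w)
        -- Were this not a leaf, the image of its successor label would be a visible element
        -- strictly below `w`.
        leafIn⇒ w rw leaf with leaf⊎suc (ψ w)
        ... | inj₁ l = l
        ... | inj₂ p with ∨-true (all<-true N leaf (<-≤-trans (proj₂ (early (ψ w) (≤-trans (≤-reflexive rw) (n≤1+n _)))) N₀≤N))
        ...   | inj₁ ≰w = ⊥-elim (true≢false (Le⇒S′ (suc (ψ w)) w p) (not-true ≰w))
        ...   | inj₂ ≡w = ⊥-elim (1+n≢n (trans (sym (ψφ _)) (cong ψ (≡ᵇ-true ≡w))))

        ⇒leafIn : ∀ w → Leaf (ψ w) → leafIn e N w ≡ true
        ⇒leafIn w leaf = all<-intro N λ u _ → dec u (S e u w) refl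
          where
          dec : ∀ u p → S e u w ≡ p → not p ∨ (u ≡ᵇ w) ≡ true
          dec u false _ = refl
          dec u true  p = ≡ᵇ-intro (ψ-injective (leaf (ψ u) (S⇒Le u w p)))

        leafChild⇒ : ∀ q → leafChild e N q ≡ true → LeafChild e (ψ q)
        leafChild⇒ q eq =
          let w , _ , p = any<-true N eq ; a , p′ = ∧-true p ; b , c = ∧-true p′
              rw = up⇒rank w (2 + e) ≤-refl (≡ᵇ-true b)
          in ψ w , S⇒Le w q a , rw , leafIn⇒ w rw c

        ⇒leafChild : ∀ q → LeafChild e (ψ q) → leafChild e N q ≡ true
        ⇒leafChild q (w , p , rw , leaf) = any<-intro N
          (<-≤-trans (proj₁ (early w (≤-trans (≤-reflexive rw) (n≤1+n _)))) N₀≤N)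
          (∧-intro (Le⇒S′ w q p) (∧-intro
            (≡ᵇ-intro (rank⇒up (φ w) (2 + e) ≤-refl (trans (cong rank (ψφ w)) rw)))
            (⇒leafIn (φ w) (subst Leaf (sym (ψφ w)) leaf))))

        -- Together with `zeroSide-complete`: beyond `N₀` the test no longer depends on `N`.
        zeroSide-sound : ∀ z → zeroSide e N z ≡ true → ZeroSide e (ψ z)
        zeroSide-sound z eq =
          let q , _ , p = any<-true N eq ; a , p′ = ∧-true p ; b , p″ = ∧-true p′ ; c , f = ∧-true p″
          in ψ q , S⇒Le z q a , (λ eq → ≢ᵇ-true b (ψ-injective eq)) , up⇒rank q (1 + e) (n≤1+n _) (≡ᵇ-true c) ,
             λ lc → true≢false (⇒leafChild q lc) (not-true f)

        zeroSide-complete : ∀ z → ZeroSide e (ψ z) → zeroSide e N z ≡ true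
        zeroSide-complete z (q , p , z≢q , rq , noLeaf) = any<-intro N
          (<-≤-trans (proj₁ (early q (≤-trans (≤-reflexive rq) (m≤n+m _ 2)))) N₀≤N)
          (∧-intro (Le⇒S z q p) (∧-intro (≢ᵇ-intro z (φ q) λ { refl → z≢q (ψφ q) }) (∧-intro
            (≡ᵇ-intro (rank⇒up (φ q) (1 + e) (n≤1+n _) (trans (cong rank (ψφ q)) rq)))
            (none (leafChild e N (φ q)) refl))))
          where
          none : ∀ p → leafChild e N (φ q) ≡ p → not p ≡ true
          none false _ = refl
          none true  p = ⊥-elim (noLeaf (subst (LeafChild e) (ψφ q) (leafChild⇒ (φ q) p)))

      N₀≤t*4 : ∀ {t} → N₀ ≤ t → N₀ ≤ t * 4
      N₀≤t*4 {t} le = ≤-trans le (m≤m*n t 4)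

      size-mono : ∀ {t t′} → N₀ ≤ t → t ≤ t′ → size e (t * 4) ≤ size e (t′ * 4)
      size-mono {t} {t′} N₀≤t t≤t′ = count-injection (t * 4) (t′ * 4) _≡_ (λ p q → trans p (sym q)) λ z z< p →
        z , <-≤-trans z< (*-monoˡ-≤ 4 t≤t′) ,
        zeroSide-complete (N₀≤t*4 (≤-trans N₀≤t t≤t′)) z (zeroSide-sound (N₀≤t*4 N₀≤t) z p) , refl

      -- An excess at `t` keeps `lastZero` fixed and, as `size` does not shrink, recurs forever. All
      -- stages with bit 0 then come before `lastZero e t`, so their labels are too few for the
      -- 0-side that `S` shows.
      no-excess : ∀ {t} → N₀ ≤ t → d e t ≢ true
      no-excess {t} N₀≤t dt = <-irrefl refl (<-≤-trans (<ᵇ-true dt)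
        (count≤ (t * 4) (lastZero e t * 3) (λ z x → ψ z ≡ x) (λ p q → ψ-injective (trans p (sym q))) λ z _ p →
          ψ z , stg<⇒< (small (stg (ψ z)) (zeroSide⇒ (zeroSide-sound (N₀≤t*4 N₀≤t) z p))) , refl))
        where
        frozen : ∀ k → lastZero e (k + t) ≡ lastZero e t × d e (k + t) ≡ true
        frozen zero    = refl , dt
        frozen (suc k) with frozen k
        ... | fix , dk = fix′ , <ᵇ-intro (subst (λ b → b * 3 < size e (suc (k + t) * 4)) (sym fix′)
                            (<-≤-trans (<ᵇ-true dt) (size-mono N₀≤t (m≤n+m t (suc k)))))
          where
          fix′ : lastZero e (suc k + t) ≡ lastZero e t
          fix′ rewrite dk = fix
        small : ∀ s → d e s ≡ false → s < lastZero e t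
        small s ds with s <? t
        ... | yes s<t = <lastZero e t ds s<t
        ... | no s≮t  = ⊥-elim (true≢false (subst (λ u → d e u ≡ true) (m∸n+n≡m (≮⇒≥ s≮t)) (proj₂ (frozen (s ∸ t)))) ds)

      -- Labels from `L` on belong to deep stages with bit 0, so at most `L` elements of `S` are off
      -- the 0-side. Without an excess at most `t * 3` are on it, yet `t * 4` are shown and `t`
      -- exceeds `L`.
      impossible : ∀ M → (∀ t → ℓ t ≤ 3 + e → t < M) → ⊥
      impossible M shallow = <-irrefl refl (+-cancelˡ-≤ (t * 3) (suc L) L (≤-trans (≤-trans
        (+-monoʳ-≤ (t * 3) (m≤m+n (suc L) N₀)) (≤-reflexive (trans (+-comm (t * 3) t) (sym (*-suc t 3)))))
        total≤))
        where
        L t : ℕ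
        L = (M + N₀) * 3
        t = suc L + N₀
        N₀≤t : N₀ ≤ t
        N₀≤t = m≤n+m N₀ (suc L)
        late : ∀ x → L ≤ x → ZeroSide e x
        late x L≤x = ⇒zeroSide (¬true (no-excess (≤-trans (m≤n+m N₀ M) stage≥)))
            (≤-trans (n≤1+n _) (<⇒≤ (≰⇒> λ ℓ≤ → <-irrefl refl (<-≤-trans (shallow (stg x) ℓ≤) (≤-trans (m≤m+n M N₀) stage≥)))))
          where
          stage≥ : M + N₀ ≤ stg x
          stage≥ = ≮⇒≥ λ lt → <-irrefl refl (<-≤-trans (stg<⇒< lt) L≤x)
          ¬true : ∀ {p} → p ≢ true → p ≡ false
          ¬true {true}  h = ⊥-elim (h refl)
          ¬true {false} h = refl
        others : count (t * 4) (not ∘ zeroSide e (t * 4)) ≤ L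
        others = count≤ (t * 4) L (λ z x → ψ z ≡ x) (λ p q → ψ-injective (trans p (sym q))) λ z _ p →
          ψ z , ≰⇒> (λ L≤ → true≢false (zeroSide-complete (N₀≤t*4 N₀≤t) z (late (ψ z) L≤)) (not-true p)) , refl
        few : size e (t * 4) ≤ t * 3
        few = ≮⇒≥ λ lt → no-excess N₀≤t (<ᵇ-intro (≤-<-trans (*-monoˡ-≤ 3 (lastZero≤ e t)) lt))
        total≤ : t * 4 ≤ t * 3 + L
        total≤ = subst (_≤ t * 3 + L) (count-not (t * 4) (zeroSide e (t * 4))) (+-mono-≤ few others)

    not-isomorphic : ⊥
    -- The goal is `⊥`, so the double negation can be eliminated. The successor in `suc (M * 3)`
    -- makes room for the successor labels.
    not-isomorphic = ℓ-bounded (3 + e) λ (M , shallow) →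
      let N₀ , bound = image-bound φ (suc (M * 3)) in
      Stable.impossible N₀ (λ x rx → let x< = stg<⇒< (shallow (stg x) (≤-trans (ℓ≤rank x) rx)) in
        bound x (m≤n⇒m≤1+n x<) , bound (suc x) (s≤s x<)) M shallow

  -- Computability of the bits

  module _ (SR : Rel₃ S) where
    upF : Fun₃ up
    upF = fun₃ (countC (var 1F) (appB₃ (var 1F) (var 3F) (var 0F) SR))

    leafInR : Rel₃ leafIn
    leafInR = rel₃ (allC (var 1F) (orC (notC (appB₃ (var 1F) (var 0F) (var 3F) SR)) (eqC (var 0F) (var 3F))))

    leafChildR : Rel₃ leafChild
    leafChildR = rel₃ (anyC (var 1F) (andC (appB₃ (var 1F) (var 0F) (var 3F) SR)
      (andC (eqC (app₃ (var 1F) (var 2F) (var 0F) upF) (addC (numC 3) (var 1F)))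
        (appB₃ (var 1F) (var 2F) (var 0F) leafInR))))

    zeroSideR : Rel₃ zeroSide
    zeroSideR = rel₃ (anyC (var 1F) (andC (appB₃ (var 1F) (var 3F) (var 0F) SR)
      (andC (notC (eqC (var 3F) (var 0F)))
      (andC (eqC (app₃ (var 1F) (var 2F) (var 0F) upF) (addC (numC 2) (var 1F)))
        (notC (appB₃ (var 1F) (var 2F) (var 0F) leafChildR))))))

    sizeF : Fun₂ size
    sizeF = fun₂ (countC (var 1F) (appB₃ (var 1F) (var 2F) (var 0F) zeroSideR))

    excessR : Rel₃ excess
    excessR = rel₃ (ltC (mulC (var 2F) (numC 3)) (app₂ (var 0F) (mulC (var 1F) (numC 4)) sizeF))

    lastZeroF : Fun₂ lastZero
    lastZeroF = fun₂ (recAt (λ k xs → lastZero (lookup xs 0F) k) (λ _ → refl) (λ _ _ → refl) (numC 0)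
      (ifC (appB₃ (var 2F) (var 0F) (var 1F) excessR) (var 1F) (sucC (var 0F))) (var 1F))

    dR : Rel₂ d
    dR = rel₂ (appB₃ (var 0F) (var 1F) (app₂ (var 0F) (var 1F) lastZeroF) excessR)

theorem8 : Σ BinRel λ R → Computable R × IsPosetTree R ×
    ((S : BinRel) → Punctual S → IsPosetTree S → ¬ Isomorphic R S)
theorem8 = R , R-computable (dR enumR) , isPosetTree , λ S punctual _ (f , order) →
  -- Pointwise equality suffices to turn an isomorphism onto `S` into one onto `enum e`.
  let e , enum≡S = punctual-enum S punctual in
  not-isomorphic e (f , λ x y →
    (λ p → trans (enum≡S _ _) (proj₁ (order x y) p)) , λ p → proj₂ (order x y) (trans (sym (enum≡S _ _)) p))
  where
  open Diagonal enum
  open Tree d
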